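{- Assume that $M,N\colon G\to\mathbb C$ satisfy $\beta(M)\ge\beta(N)$ and $\Psi_M\Psi_{N,N}\ne0$. (i) Assume that $\Psi_M\overline{\Psi_{M,N}}\ne\Psi_N\Psi_{M,M}$. Then $\Psi_N\Psi_{M,N}\neq\Psi_M\Psi_{N,N}$, and hence, for $\alpha\in\mathbb C$, the maximum of $\beta(M+\alpha N)$ occurs for $$\alpha=\alpha_1:=\frac{\overline{\Psi_M}\Psi_{M,N}-\overline{\Psi_N}\Psi_{M,M}}{\overline{\Psi_N}\,\overline{\Psi_{M,N}}-\overline{\Psi_M}\Psi_{N,N}}$$ and is $$\beta(M+\alpha_1N)=\frac{|\Psi_N|^2\Psi_{M,M}+|\Psi_M|^2\Psi_{N,N}-2\mathrm{Re}(\overline{\Psi_M}\Psi_N\Psi_{M,N})}{\Psi_{M,M}\Psi_{N,N}-|\Psi_{M,N}|^2}=\beta(M)+\frac{|\overline{\Psi_M}\Psi_{M,N}-\overline{\Psi_N}\Psi_{M,M}|^2}{\Psi_{M,M}(\Psi_{M,M}\Psi_{N,N}-|\Psi_{M,N}|^2)},$$ where the denominators in these expressions for $\beta(M+\alpha_1N)$ are positive. In particular, $$\beta(M+\alpha_1N)>\beta(M).$$ (ii) Assume that $\Psi_M\overline{\Psi_{M,N}}=\Psi_N\Psi_{M,M}$. Then $\beta(M+\alpha N)\le\beta(M)$ for every $\alpha\in\mathbb C$.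
   Context: $G$ is an (indexing) set, $L\colon G\to\mathbb C$ is a function, and $w\colon G\to[0,\infty)$ is a weight function, not identically $0$. For $f\colon G\to\mathbb C$ put $\mathbb E^w_{\pi\in G}f(\pi):=\frac{\sum_{\pi\in G}w(\pi)f(\pi)}{\sum_{\pi\in G}w(\pi)}$. For $M,N\colon G\to\mathbb C$ define $\Psi_M:=\mathbb E^w_{\pi\in G}L(\pi)M(\pi)$, $\Psi_{M,N}:=\mathbb E^w_{\pi\in G}L(\pi)M(\pi)\overline{L(\pi)N(\pi)}$, and $\beta(M):=|\Psi_M|^2/\Psi_{M,M}$ if $\Psi_{M,M}\ne0$, $\beta(M):=0$ if $\Psi_{M,M}=0$. It is assumed that the series $\sum_\pi w(\pi)$ and $\sum_\pi w(\pi)|L(\pi)M(\pi)|^2$ converge for every function $M$ considered (automatic if $G$ is finite). -}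

module Defs where

open import Algebra.Structures using (IsCommutativeRing)
open import Axiom.ExcludedMiddle using (ExcludedMiddle)
open import Data.List.Base using (List; []; _∷_)
open import Data.List.Relation.Binary.Subset.Propositional using (_⊆_)
open import Data.List.Relation.Unary.Unique.Propositional using (Unique)
open import Data.Product.Base using (∃; _×_; _,_; proj₁)
open import Level using (0ℓ)
open import Relation.Binary.Structures using (IsTotalOrder)
open import Relation.Nullary using (¬_; yes; no)
import Relation.Binary.Construct.NonStrictToStrict as Strict

-- The real numbers, presented as a Dedekind-complete ordered field; classically
-- these axioms determine ℝ up to unique isomorphism. The carrier is a setoid
-- so that constructions of ℝ by Cauchy sequences are models.
record RealNumbers : Set₁ where
  infix  4 _≈_ _≤_
  infixl 6 _+_
  infixl 7 _*_
  infix  8 -_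
  field
    ℝ   : Set
    _≈_ : ℝ → ℝ → Set
    _≤_ : ℝ → ℝ → Set
    _+_ : ℝ → ℝ → ℝ
    _*_ : ℝ → ℝ → ℝ
    -_  : ℝ → ℝ
    0ℝ  : ℝ
    1ℝ  : ℝ

    isCommutativeRing : IsCommutativeRing _≈_ _+_ _*_ -_ 0ℝ 1ℝ
    0≉1               : ¬ (0ℝ ≈ 1ℝ)
    inverse           : ∀ x → ¬ (x ≈ 0ℝ) → ∃ λ y → x * y ≈ 1ℝ

    isTotalOrder      : IsTotalOrder _≈_ _≤_
    +-monoʳ-≤         : ∀ x {y z} → y ≤ z → x + y ≤ x + z
    *-nonNegative     : ∀ {x y} → 0ℝ ≤ x → 0ℝ ≤ y → 0ℝ ≤ x * y

  UpperBound : (ℝ → Set) → ℝ → Set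
  UpperBound P b = ∀ x → P x → x ≤ b

  field
    supremum : ∀ (P : ℝ → Set) → ∃ P → ∃ (UpperBound P) →
               ∃ λ s → UpperBound P s × (∀ b → UpperBound P b → s ≤ b)

-- Excluded middle supplies the case distinctions of classical analysis:
-- whether a denominator vanishes, and whether a series converges.
module Analysis (em : ExcludedMiddle 0ℓ) (𝓡 : RealNumbers) where

  open RealNumbers 𝓡 public
  open Strict _≈_ _≤_ public using (_<_)

  infixl 6 _-_
  infixl 7 _/_

  _-_ : ℝ → ℝ → ℝ
  x - y = x + - y

  -- Division by zero returns zero.
  _/_ : ℝ → ℝ → ℝ
  x / y with em {y ≈ 0ℝ}
  ... | yes _  = 0ℝ
  ... | no y≉0 = x * proj₁ (inverse y y≉0)

  infix  5 _+i_
  infix  4 _≈ᶜ_ _≉ᶜ_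
  infixl 6 _+ᶜ_ _-ᶜ_
  infixl 7 _*ᶜ_ _/ᶜ_

  record ℂ : Set where
    constructor _+i_
    field
      re : ℝ
      im : ℝ

  open ℂ public

  _≈ᶜ_ : ℂ → ℂ → Set
  z ≈ᶜ u = (re z ≈ re u) × (im z ≈ im u)

  _≉ᶜ_ : ℂ → ℂ → Set
  z ≉ᶜ u = ¬ (z ≈ᶜ u)

  ofReal : ℝ → ℂ
  ofReal x = x +i 0ℝ

  0ᶜ : ℂ
  0ᶜ = ofReal 0ℝ

  _+ᶜ_ : ℂ → ℂ → ℂ
  z +ᶜ u = (re z + re u) +i (im z + im u)

  _-ᶜ_ : ℂ → ℂ → ℂ
  z -ᶜ u = (re z - re u) +i (im z - im u)

  _*ᶜ_ : ℂ → ℂ → ℂ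
  z *ᶜ u = (re z * re u - im z * im u) +i (re z * im u + im z * re u)

  conj : ℂ → ℂ
  conj z = re z +i (- im z)

  ∣_∣² : ℂ → ℝ
  ∣ z ∣² = re z * re z + im z * im z

  _/ᶜ_ : ℂ → ℂ → ℂ
  z /ᶜ u = (re (z *ᶜ conj u) / ∣ u ∣²) +i (im (z *ᶜ conj u) / ∣ u ∣²)

  module _ {G : Set} where

    finiteSum : (G → ℂ) → List G → ℂ
    finiteSum f []      = 0ᶜ
    finiteSum f (π ∷ S) = f π +ᶜ finiteSum f S

    -- Unordered summation: the net of sums over finite subsets of G, listed
    -- without repetition, tends to s. The final inequality is |∑_T f - s| < ε,
    -- squared so that no square root is needed.
    HasSum : (G → ℂ) → ℂ → Set
    HasSum f s =
      ∀ ε → 0ℝ < ε →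
      ∃ λ (S : List G) → ∀ (T : List G) → Unique T → S ⊆ T →
      ∣ finiteSum f T -ᶜ s ∣² < ε * ε

    Summable : (G → ℂ) → Set
    Summable f = ∃ (HasSum f)

    -- The value is a convention when the series does not converge.
    ∑ : (G → ℂ) → ℂ
    ∑ f with em {Summable f}
    ... | yes (s , _) = s
    ... | no _        = 0ᶜ

  module Weighted {G : Set} (L : G → ℂ) (w : G → ℝ) where

    𝔼 : (G → ℂ) → ℂ
    𝔼 f = ∑ (λ π → ofReal (w π) *ᶜ f π) /ᶜ ∑ (λ π → ofReal (w π))

    Ψ : (G → ℂ) → ℂ
    Ψ M = 𝔼 (λ π → L π *ᶜ M π)

    Ψ₂ : (G → ℂ) → (G → ℂ) → ℂ
    Ψ₂ M N = 𝔼 (λ π → (L π *ᶜ M π) *ᶜ conj (L π *ᶜ N π))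

    -- Ψ₂ M M is a weighted mean of |L M|², hence a complex number with zero
    -- imaginary part; ‖ M ‖² is that number as an element of ℝ.
    ‖_‖² : (G → ℂ) → ℝ
    ‖ M ‖² = re (Ψ₂ M M)

    β : (G → ℂ) → ℝ
    β M with em {Ψ₂ M M ≈ᶜ 0ᶜ}
    ... | yes _ = 0ℝ
    ... | no _  = ∣ Ψ M ∣² / ‖ M ‖²

    infixl 6 _⊹_·_

    _⊹_·_ : (G → ℂ) → ℂ → (G → ℂ) → (G → ℂ)
    (M ⊹ α · N) π = M π +ᶜ α *ᶜ N π

    SquareSummable : (G → ℂ) → Set
    SquareSummable M = Summable (λ π → ofReal (w π * ∣ L π *ᶜ M π ∣²))

{-# OPTIONS --safe #-}

-- The identity E·Ψ_FF = D·|Ψ_F|² + |z − αu|² for F = M + αN, where z/u = α₁, D is the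
-- Gram determinant and E the numerator of the claimed maximum, shows at once that
-- β(F) ≤ E/D, with equality at α = α₁; likewise E·Ψ_MM = D·|Ψ_M|² + |z|² gives the
-- gain over β(M). Positivity comes from |Ψ_F|² ≤ Ψ_FF (a variance is nonnegative):
-- for F = conj(Ψ_MN) M − Ψ_MM N it reads |z|² ≤ D·Ψ_MM, and z ≠ 0 in case (i).
-- In case (ii), Ψ_MM (Ψ_M + αΨ_N) = Ψ_M (Ψ_MM + α conj(Ψ_MN)), and the bound follows from
-- Ψ_MM Ψ_FF = |Ψ_MM + α conj(Ψ_MN)|² + |α|² D.
module Submission where

open import Defs
open import Algebra.Bundles using (CommutativeRing)
import Algebra.Solver.Ring
open import Algebra.Solver.Ring.AlmostCommutativeRing
  using (fromCommutativeRing; _-Raw-AlmostCommutative⟶_)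
open import Axiom.ExcludedMiddle using (ExcludedMiddle)
open import Data.Empty using (⊥-elim)
open import Data.Integer.Base as ℤ using (ℤ)
import Data.Integer.Properties as ℤₚ
open import Data.List.Base using (List; []; _∷_; _++_; deduplicate)
open import Data.List.Membership.Propositional.Properties
  using (∈-∃++; ∈-++⁻; ∈-++⁺ˡ; ∈-++⁺ʳ; ∈-deduplicate⁺)
open import Data.List.Relation.Binary.Subset.Propositional using (_⊆_)
open import Data.List.Relation.Binary.Subset.Propositional.Properties
  using (⊆-trans; xs⊆xs++ys; xs⊆ys++xs)
open import Data.List.Relation.Unary.All using ([]; lookup)
open import Data.List.Relation.Unary.AllPairs using ([]; _∷_)
open import Data.List.Relation.Unary.Any using (here; there)
open import Data.List.Relation.Unary.Unique.DecPropositional.Properties using (deduplicate-!)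
open import Data.List.Relation.Unary.Unique.Propositional using (Unique)
import Data.Maybe.Base as Maybe
open import Data.Nat.Base as ℕ using (ℕ; zero; suc)
import Data.Nat.Properties as ℕₚ
open import Data.Product.Base using (Σ; ∃; _×_; _,_; proj₁; proj₂)
import Data.Sign.Base as Sign
open import Data.Sum.Base using (inj₁; inj₂)
open import Level using (0ℓ)
open import Relation.Binary.Bundles using (Poset)
open import Relation.Binary.Consequences using (dec⇒weaklyDec)
import Relation.Binary.PropositionalEquality.Core as ≡
open ≡ using (_≡_)
import Relation.Binary.Reasoning.PartialOrder as PartialOrderReasoning
import Relation.Binary.Reasoning.Setoid as SetoidReasoning
open import Relation.Binary.Structures using (IsTotalOrder)
open import Relation.Nullary using (¬_; yes; no)

-- The overview treats the `Ψ` values as numbers obeying linear algebra. The obstacle is that `∑`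
-- returns zero on a divergent series, so linearity of `𝔼` is available only for families known to
-- converge, while convergence is assumed only for the weights and the squared moduli. Hence means
-- are handled through the relation `HasMean`, the existence of every mean is derived by domination,
-- and only then is `𝔼` identified with the limit. The quotient `E / D` is the squared dual norm of
-- the functional `Ψ` on the span of `M` and `N`: `E` is the adjugate of the Gram form at
-- `(Ψ M, Ψ N)`, and the identity for `E` is the exact Cauchy-Schwarz defect, one square because the
-- form has two variables. Equality selects the direction `u M + z N`. If `u` vanished, the optimum
-- would be `N` itself, which no `α` reaches, and `β N` would equal `E / D`, more than `β M`; the
-- hypothesis `β N ≤ β M` excludes this.

-- Ring normalisation with integer coefficients.

module IntegerSolver {c ℓ} (R : CommutativeRing c ℓ) where

  open import Data.Integer.Base using (+_; -[1+_]; +[1+_]; _⊖_; _◃_)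
  open CommutativeRing R hiding (zero)
  open import Algebra.Properties.Ring ring using (-‿distribˡ-*; -‿distribʳ-*)
  open import Algebra.Properties.AbelianGroup +-abelianGroup
  open import Algebra.Properties.Semiring.Mult.TCOptimised semiring
    using (1+×; ×-homo-+; ×1-homo-*) renaming (_×_ to _·_)
  open SetoidReasoning setoid

  -- Integer coefficients compute and have decidable equality, so terms cancel during normalisation
  -- over an abstract ring. With the optimised multiples, the images of 0 and 1 reduce to `0#` and
  -- `1#`; hence `:0` and `:1` match `0ℝ` and `1ℝ` definitionally.
  fromℤ : ℤ → Carrier
  fromℤ (+ n)    = n · 1#
  fromℤ -[1+ n ] = - (suc n · 1#)

  fromℤ-neg : ∀ i → fromℤ (ℤ.- i) ≈ - fromℤ i
  fromℤ-neg (+ zero)  = sym ε⁻¹≈ε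
  fromℤ-neg +[1+ n ]  = refl
  fromℤ-neg -[1+ n ]  = sym (⁻¹-involutive _)

  fromℤ-⊖ : ∀ m n → fromℤ (m ⊖ n) ≈ m · 1# - n · 1#
  fromℤ-⊖ m       zero    = sym (trans (+-congˡ ε⁻¹≈ε) (+-identityʳ _))
  fromℤ-⊖ zero    (suc n) = sym (+-identityˡ _)
  fromℤ-⊖ (suc m) (suc n) = begin
    fromℤ (suc m ⊖ suc n)                ≡⟨ ≡.cong fromℤ (ℤₚ.[1+m]⊖[1+n]≡m⊖n m n) ⟩
    fromℤ (m ⊖ n)                        ≈⟨ fromℤ-⊖ m n ⟩
    m · 1# - n · 1#                      ≈⟨ +-congʳ (xyx⁻¹≈y 1# _) ⟨
    (1# + m · 1#) - 1# - n · 1#          ≈⟨ +-assoc _ _ _ ⟩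
    (1# + m · 1#) + (- 1# - n · 1#)      ≈⟨ +-congˡ (⁻¹-∙-comm 1# _) ⟩
    (1# + m · 1#) - (1# + n · 1#)        ≈⟨ +-cong (1+× m 1#) (-‿cong (1+× n 1#)) ⟨
    suc m · 1# - suc n · 1#              ∎

  fromℤ-+ : ∀ i j → fromℤ (i ℤ.+ j) ≈ fromℤ i + fromℤ j
  fromℤ-+ (+ m)    (+ n)    = ×-homo-+ 1# m n
  fromℤ-+ (+ m)    -[1+ n ] = fromℤ-⊖ m (suc n)
  fromℤ-+ -[1+ m ] (+ n)    = trans (fromℤ-⊖ n (suc m)) (+-comm _ _)
  fromℤ-+ -[1+ m ] -[1+ n ] = begin
    - (suc (suc (m ℕ.+ n)) · 1#)         ≡⟨ ≡.cong (λ k → - (k · 1#)) (≡.sym (ℕₚ.+-suc (suc m) n)) ⟩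
    - ((suc m ℕ.+ suc n) · 1#)           ≈⟨ -‿cong (×-homo-+ 1# (suc m) (suc n)) ⟩
    - (suc m · 1# + suc n · 1#)          ≈⟨ ⁻¹-∙-comm _ _ ⟨
    - (suc m · 1#) - suc n · 1#          ∎

  fromℤ-◃- : ∀ n → fromℤ (Sign.- ◃ n) ≈ - (n · 1#)
  fromℤ-◃- zero    = sym ε⁻¹≈ε
  fromℤ-◃- (suc n) = refl

  fromℤ-* : ∀ i j → fromℤ (i ℤ.* j) ≈ fromℤ i * fromℤ j
  fromℤ-* (+ m)    (+ n)    = begin
    fromℤ (Sign.+ ◃ m ℕ.* n)          ≡⟨ ≡.cong fromℤ (ℤₚ.+◃n≡+n (m ℕ.* n)) ⟩
    (m ℕ.* n) · 1#                    ≈⟨ ×1-homo-* m n ⟩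
    m · 1# * n · 1#                   ∎
  fromℤ-* (+ m)    -[1+ n ] = begin
    fromℤ (Sign.- ◃ m ℕ.* suc n)      ≈⟨ fromℤ-◃- (m ℕ.* suc n) ⟩
    - ((m ℕ.* suc n) · 1#)            ≈⟨ -‿cong (×1-homo-* m (suc n)) ⟩
    - (m · 1# * suc n · 1#)           ≈⟨ -‿distribʳ-* _ _ ⟩
    m · 1# * - (suc n · 1#)           ∎
  fromℤ-* -[1+ m ] (+ n)    = begin
    fromℤ (Sign.- ◃ suc m ℕ.* n)      ≈⟨ fromℤ-◃- (suc m ℕ.* n) ⟩
    - ((suc m ℕ.* n) · 1#)            ≈⟨ -‿cong (×1-homo-* (suc m) n) ⟩
    - (suc m · 1# * n · 1#)           ≈⟨ -‿distribˡ-* _ _ ⟩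
    - (suc m · 1#) * n · 1#           ∎
  fromℤ-* -[1+ m ] -[1+ n ] = begin
    (suc m ℕ.* suc n) · 1#            ≈⟨ ×1-homo-* (suc m) (suc n) ⟩
    suc m · 1# * suc n · 1#           ≈⟨ ⁻¹-involutive _ ⟨
    - - (suc m · 1# * suc n · 1#)     ≈⟨ -‿cong (-‿distribʳ-* _ _) ⟩
    - (suc m · 1# * - (suc n · 1#))   ≈⟨ -‿distribˡ-* _ _ ⟩
    - (suc m · 1#) * - (suc n · 1#)   ∎

  morphism : ℤ.+-*-rawRing -Raw-AlmostCommutative⟶ fromCommutativeRing R
  morphism = record
    { ⟦_⟧    = fromℤ
    ; +-homo = fromℤ-+
    ; *-homo = fromℤ-*
    ; -‿homo = fromℤ-neg
    ; 0-homo = refl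
    ; 1-homo = refl
    }

  open Algebra.Solver.Ring ℤ.+-*-rawRing (fromCommutativeRing R) morphism
    (λ i j → Maybe.map (λ i≡j → reflexive (≡.cong fromℤ i≡j)) (dec⇒weaklyDec ℤₚ._≟_ i j))
    public
    using (Polynomial; con; _:+_; _:*_; _:-_; :-_; solve; _:=_)

  :0 :1 : ∀ {n} → Polynomial n
  :0 = con (+ 0)
  :1 = con (+ 1)

-- Ordered-field arithmetic and division.

module OrderedField (em : ExcludedMiddle 0ℓ) (𝓡 : RealNumbers) where

  open Analysis em 𝓡

  ℝ-commutativeRing : CommutativeRing 0ℓ 0ℓ
  ℝ-commutativeRing = record { isCommutativeRing = isCommutativeRing }

  open IntegerSolver ℝ-commutativeRing public
  open CommutativeRing ℝ-commutativeRing public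
    using (+-cong; +-congˡ; +-congʳ; *-cong; *-congˡ; *-congʳ; -‿cong; zeroˡ; zeroʳ;
           +-identityˡ; +-identityʳ; *-identityˡ; *-identityʳ; *-assoc; *-comm; +-comm; -‿inverseʳ)
    renaming (refl to ≈-refl; sym to ≈-sym; trans to ≈-trans; reflexive to ≈-reflexive)
  open IsTotalOrder isTotalOrder public
    using (total; antisym; ≤-respˡ-≈; ≤-respʳ-≈)
    renaming (refl to ≤-refl; trans to ≤-trans; reflexive to ≤-reflexive)

  poset : Poset 0ℓ 0ℓ 0ℓ
  poset = record { isPartialOrder = IsTotalOrder.isPartialOrder isTotalOrder }

  module ≤-Reasoning = PartialOrderReasoning poset

  2ℝ : ℝ
  2ℝ = 1ℝ + 1ℝ

  -- The usual route to an inequality below: name the slack `e` and leave an identity, mostly one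
  -- for the ring solver.
  ≤-intro : ∀ {x y e} → 0ℝ ≤ e → x + e ≈ y → x ≤ y
  ≤-intro {x} {y} {e} 0≤e eq = begin
    x       ≈⟨ +-identityʳ x ⟨
    x + 0ℝ  ≤⟨ +-monoʳ-≤ x 0≤e ⟩
    x + e   ≈⟨ eq ⟩
    y       ∎
    where open ≤-Reasoning

  x≤y⇒0≤y-x : ∀ {x y} → x ≤ y → 0ℝ ≤ y - x
  x≤y⇒0≤y-x {x} {y} x≤y = begin
    0ℝ         ≈⟨ solve 1 (λ x → :0 := :- x :+ x) ≈-refl x ⟩
    - x + x    ≤⟨ +-monoʳ-≤ (- x) x≤y ⟩
    - x + y    ≈⟨ +-comm (- x) y ⟩
    y - x      ∎
    where open ≤-Reasoning

  0≤y-x⇒x≤y : ∀ {x y} → 0ℝ ≤ y - x → x ≤ y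
  0≤y-x⇒x≤y {x} {y} p = ≤-intro p (solve 2 (λ x y → x :+ (y :- x) := y) ≈-refl x y)

  +-mono-≤ : ∀ {x y u v} → x ≤ y → u ≤ v → x + u ≤ y + v
  +-mono-≤ {x} {y} {u} {v} x≤y u≤v = begin
    x + u  ≤⟨ +-monoʳ-≤ x u≤v ⟩
    x + v  ≈⟨ +-comm x v ⟩
    v + x  ≤⟨ +-monoʳ-≤ v x≤y ⟩
    v + y  ≈⟨ +-comm v y ⟩
    y + v  ∎
    where open ≤-Reasoning

  +-nonNegative : ∀ {x y} → 0ℝ ≤ x → 0ℝ ≤ y → 0ℝ ≤ x + y
  +-nonNegative p q = ≤-respˡ-≈ (+-identityˡ 0ℝ) (+-mono-≤ p q)

  *-monoˡ-≤ : ∀ {c x y} → 0ℝ ≤ c → x ≤ y → c * x ≤ c * y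
  *-monoˡ-≤ {c} {x} {y} 0≤c x≤y = ≤-intro (*-nonNegative 0≤c (x≤y⇒0≤y-x x≤y))
    (solve 3 (λ c x y → c :* x :+ c :* (y :- x) := c :* y) ≈-refl c x y)

  x≤0⇒0≤-x : ∀ {x} → x ≤ 0ℝ → 0ℝ ≤ - x
  x≤0⇒0≤-x {x} x≤0 = ≤-respʳ-≈ (+-identityˡ (- x)) (x≤y⇒0≤y-x x≤0)

  square-nonNegative : ∀ x → 0ℝ ≤ x * x
  square-nonNegative x with total 0ℝ x
  ... | inj₁ 0≤x = *-nonNegative 0≤x 0≤x
  ... | inj₂ x≤0 = ≤-respʳ-≈ (solve 1 (λ x → :- x :* :- x := x :* x) ≈-refl x)
                     (*-nonNegative (x≤0⇒0≤-x x≤0) (x≤0⇒0≤-x x≤0))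

  ∣∣²-nonNegative : ∀ z → 0ℝ ≤ ∣ z ∣²
  ∣∣²-nonNegative z = +-nonNegative (square-nonNegative (re z)) (square-nonNegative (im z))

  0<1 : 0ℝ < 1ℝ
  0<1 = ≤-respʳ-≈ (*-identityˡ 1ℝ) (square-nonNegative 1ℝ) , 0≉1

  positive⇒≉0 : ∀ {x} → 0ℝ < x → ¬ (x ≈ 0ℝ)
  positive⇒≉0 (_ , 0≉x) x≈0 = 0≉x (≈-sym x≈0)

  <-≤-trans : ∀ {x y z} → x < y → y ≤ z → x < z
  <-≤-trans (x≤y , x≉y) y≤z =
    ≤-trans x≤y y≤z , λ x≈z → x≉y (antisym x≤y (≤-trans y≤z (≤-reflexive (≈-sym x≈z))))

  +-positive : ∀ {x y} → 0ℝ < x → 0ℝ ≤ y → 0ℝ < x + y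
  +-positive {x} {y} 0<x 0≤y = <-≤-trans 0<x (≤-intro 0≤y ≈-refl)

  0<2 : 0ℝ < 2ℝ
  0<2 = +-positive 0<1 (proj₁ 0<1)

  nonNegative∧≉0⇒positive : ∀ {x} → 0ℝ ≤ x → ¬ (x ≈ 0ℝ) → 0ℝ < x
  nonNegative∧≉0⇒positive 0≤x x≉0 = 0≤x , λ 0≈x → x≉0 (≈-sym 0≈x)

  x*y≈0⇒x≈0 : ∀ {x y} → x * y ≈ 0ℝ → ¬ (y ≈ 0ℝ) → x ≈ 0ℝ
  x*y≈0⇒x≈0 {x} {y} xy≈0 y≉0 = begin-equality
    x              ≈⟨ *-identityʳ x ⟨
    x * 1ℝ         ≈⟨ *-congˡ yi≈1 ⟨
    x * (y * i)    ≈⟨ *-assoc x y i ⟨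
    x * y * i      ≈⟨ *-congʳ xy≈0 ⟩
    0ℝ * i         ≈⟨ zeroˡ i ⟩
    0ℝ             ∎
    where
    open ≤-Reasoning
    i = proj₁ (inverse y y≉0)
    yi≈1 = proj₂ (inverse y y≉0)

  *-positive : ∀ {x y} → 0ℝ < x → 0ℝ < y → 0ℝ < x * y
  *-positive 0<x 0<y = nonNegative∧≉0⇒positive (*-nonNegative (proj₁ 0<x) (proj₁ 0<y))
    λ xy≈0 → positive⇒≉0 0<x (x*y≈0⇒x≈0 xy≈0 (positive⇒≉0 0<y))

  -- If `x ≤ 0`, the product is squeezed to zero, which forces `x ≈ 0ℝ`. The sign of an inverse is
  -- never computed.
  *-cancelʳ-nonNegative : ∀ {x y} → 0ℝ < y → 0ℝ ≤ x * y → 0ℝ ≤ x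
  *-cancelʳ-nonNegative {x} {y} 0<y 0≤xy with total 0ℝ x
  ... | inj₁ 0≤x = 0≤x
  ... | inj₂ x≤0 = ≤-reflexive (≈-sym (x*y≈0⇒x≈0 xy≈0 (positive⇒≉0 0<y)))
    where
    xy≤0 : x * y ≤ 0ℝ
    xy≤0 = ≤-intro (*-nonNegative (x≤0⇒0≤-x x≤0) (proj₁ 0<y))
      (solve 2 (λ x y → x :* y :+ :- x :* y := :0) ≈-refl x y)
    xy≈0 = antisym xy≤0 0≤xy

  *-cancelʳ-≤ : ∀ {x y z} → 0ℝ < z → x * z ≤ y * z → x ≤ y
  *-cancelʳ-≤ {x} {y} {z} 0<z le = 0≤y-x⇒x≤y (*-cancelʳ-nonNegative 0<z
    (≤-respʳ-≈ (solve 3 (λ x y z → y :* z :- x :* z := (y :- x) :* z) ≈-refl x y z)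
      (x≤y⇒0≤y-x le)))

  *-cancelʳ-≈ : ∀ {x y z} → ¬ (z ≈ 0ℝ) → x * z ≈ y * z → x ≈ y
  *-cancelʳ-≈ {x} {y} {z} z≉0 eq = begin-equality
    x              ≈⟨ solve 2 (λ x y → x := y :+ (x :- y)) ≈-refl x y ⟩
    y + (x - y)    ≈⟨ +-congˡ (x*y≈0⇒x≈0 [x-y]z≈0 z≉0) ⟩
    y + 0ℝ         ≈⟨ +-identityʳ y ⟩
    y              ∎
    where
    open ≤-Reasoning
    [x-y]z≈0 : (x - y) * z ≈ 0ℝ
    [x-y]z≈0 = begin-equality
      (x - y) * z      ≈⟨ solve 3 (λ x y z → (x :- y) :* z := x :* z :- y :* z) ≈-refl x y z ⟩
      x * z - y * z    ≈⟨ +-congʳ eq ⟩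
      y * z - y * z    ≈⟨ -‿inverseʳ (y * z) ⟩
      0ℝ               ∎

  *-cancelʳ-positive : ∀ {x y} → 0ℝ < y → 0ℝ < x * y → 0ℝ < x
  *-cancelʳ-positive {x} {y} 0<y 0<xy = nonNegative∧≉0⇒positive
    (*-cancelʳ-nonNegative 0<y (proj₁ 0<xy))
    λ x≈0 → positive⇒≉0 0<xy (≈-trans (*-congʳ x≈0) (zeroˡ y))

  -- The only place that opens the case split in `_/_`; later facts on quotients multiply by the
  -- denominator and cancel it.
  x/y*y≈x : ∀ {x y} → ¬ (y ≈ 0ℝ) → x / y * y ≈ x
  x/y*y≈x {x} {y} y≉0 with em {y ≈ 0ℝ}
  ... | yes y≈0  = ⊥-elim (y≉0 y≈0)
  ... | no  y≉0′ = begin-equality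
    x * i * y      ≈⟨ solve 3 (λ x i y → x :* i :* y := x :* (y :* i)) ≈-refl x i y ⟩
    x * (y * i)    ≈⟨ *-congˡ (proj₂ (inverse y y≉0′)) ⟩
    x * 1ℝ         ≈⟨ *-identityʳ x ⟩
    x              ∎
    where
    open ≤-Reasoning
    i = proj₁ (inverse y y≉0′)

  /-unique : ∀ {x y z} → ¬ (y ≈ 0ℝ) → z * y ≈ x → x / y ≈ z
  /-unique y≉0 zy≈x = *-cancelʳ-≈ y≉0 (≈-trans (x/y*y≈x y≉0) (≈-sym zy≈x))

  /-upper : ∀ {x y z} → 0ℝ < y → x ≤ z * y → x / y ≤ z
  /-upper 0<y x≤zy = *-cancelʳ-≤ 0<y (≤-respˡ-≈ (≈-sym (x/y*y≈x (positive⇒≉0 0<y))) x≤zy)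

  /-nonNegative : ∀ {x y} → 0ℝ ≤ x → 0ℝ < y → 0ℝ ≤ x / y
  /-nonNegative 0≤x 0<y = *-cancelʳ-nonNegative 0<y
    (≤-respʳ-≈ (≈-sym (x/y*y≈x (positive⇒≉0 0<y))) 0≤x)

  /-positive : ∀ {x y} → 0ℝ < x → 0ℝ < y → 0ℝ < x / y
  /-positive 0<x@(0≤x , 0≉x) 0<y = *-cancelʳ-positive 0<y
    (≤-respʳ-≈ (≈-sym x/y*y≈x′) 0≤x , λ eq → 0≉x (≈-trans eq x/y*y≈x′))
    where x/y*y≈x′ = x/y*y≈x (positive⇒≉0 0<y)

  half+half : ∀ x → x / 2ℝ + x / 2ℝ ≈ x
  half+half x = ≈-trans (solve 1 (λ h → h :+ h := h :* (:1 :+ :1)) ≈-refl (x / 2ℝ))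
    (x/y*y≈x (positive⇒≉0 0<2))

  ≤-limit : ∀ {x y} → (∀ ε → 0ℝ < ε → x ≤ y + ε) → x ≤ y
  ≤-limit {x} {y} bound with total x y
  ... | inj₁ x≤y = x≤y
  ... | inj₂ y≤x with em {y ≈ x}
  ...   | yes y≈x = ≤-reflexive (≈-sym y≈x)
  ...   | no  y≉x = ⊥-elim (positive⇒≉0 0<h (antisym h≤0 (proj₁ 0<h)))
    where
    -- Half the gap: `ε = x - y` would only give the consistent `x ≤ x`, whereas `ε = h` leaves
    -- `h ≤ 0ℝ`.
    h = (x - y) / 2ℝ
    0<h : 0ℝ < h
    0<h = /-positive (nonNegative∧≉0⇒positive (x≤y⇒0≤y-x y≤x)
            λ x-y≈0 → y≉x (≈-trans (≈-trans (≈-sym (+-identityʳ y)) (+-congˡ (≈-sym x-y≈0)))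
              (solve 2 (λ x y → y :+ (x :- y) := x) ≈-refl x y))) 0<2
    h≤0 : h ≤ 0ℝ
    h≤0 = ≤-intro (x≤y⇒0≤y-x (bound h 0<h)) (begin-equality
      h + (y + h - x)
        ≈⟨ solve 3 (λ h x y → h :+ (y :+ h :- x) := (h :+ h) :- (x :- y)) ≈-refl h x y ⟩
      (h + h) - (x - y)      ≈⟨ +-congʳ (half+half (x - y)) ⟩
      (x - y) - (x - y)      ≈⟨ -‿inverseʳ (x - y) ⟩
      0ℝ                     ∎)
      where open ≤-Reasoning

-- Unordered summation of real families.

module RealSeries (em : ExcludedMiddle 0ℓ) (𝓡 : RealNumbers) {G : Set} where

  open Analysis em 𝓡
  open OrderedField em 𝓡

  partialSum : (G → ℝ) → List G → ℝ
  partialSum f []      = 0ℝ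
  partialSum f (π ∷ T) = f π + partialSum f T

  partialSum-cong : ∀ {f g} → (∀ π → f π ≈ g π) → ∀ T → partialSum f T ≈ partialSum g T
  partialSum-cong f≈g []      = ≈-refl
  partialSum-cong f≈g (π ∷ T) = +-cong (f≈g π) (partialSum-cong f≈g T)

  partialSum-+ : ∀ f g T → partialSum (λ π → f π + g π) T ≈ partialSum f T + partialSum g T
  partialSum-+ f g []      = ≈-sym (+-identityˡ 0ℝ)
  partialSum-+ f g (π ∷ T) = ≈-trans (+-congˡ (partialSum-+ f g T))
    (solve 4 (λ a b s t → (a :+ b) :+ (s :+ t) := (a :+ s) :+ (b :+ t)) ≈-refl
      (f π) (g π) (partialSum f T) (partialSum g T))

  partialSum-* : ∀ c f T → partialSum (λ π → c * f π) T ≈ c * partialSum f T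
  partialSum-* c f []      = ≈-sym (zeroʳ c)
  partialSum-* c f (π ∷ T) = ≈-trans (+-congˡ (partialSum-* c f T))
    (solve 3 (λ c a s → c :* a :+ c :* s := c :* (a :+ s)) ≈-refl c (f π) (partialSum f T))

  partialSum-mono : ∀ {f g} → (∀ π → f π ≤ g π) → ∀ T → partialSum f T ≤ partialSum g T
  partialSum-mono f≤g []      = ≤-refl
  partialSum-mono f≤g (π ∷ T) = +-mono-≤ (f≤g π) (partialSum-mono f≤g T)

  partialSum-++ : ∀ f S T → partialSum f (S ++ T) ≈ partialSum f S + partialSum f T
  partialSum-++ f []      T = ≈-sym (+-identityˡ _)
  partialSum-++ f (π ∷ S) T = ≈-trans (+-congˡ (partialSum-++ f S T))
    (solve 3 (λ a s t → a :+ (s :+ t) := (a :+ s) :+ t) ≈-refl (f π) (partialSum f S) (partialSum f T))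

  partialSum-nonNegative : ∀ {f} → (∀ π → 0ℝ ≤ f π) → ∀ T → 0ℝ ≤ partialSum f T
  partialSum-nonNegative 0≤f []      = ≤-refl
  partialSum-nonNegative 0≤f (π ∷ T) = +-nonNegative (0≤f π) (partialSum-nonNegative 0≤f T)

  -- Induction on `S`: one occurrence of its head is cut out of `T`. The head does not recur in `S`,
  -- so the tail of `S` still lies in what remains of `T`.
  partialSum-⊆ : ∀ {f} → (∀ π → 0ℝ ≤ f π) → ∀ {S T} → Unique S → S ⊆ T →
                 partialSum f S ≤ partialSum f T
  partialSum-⊆ 0≤f {[]}    {T} _           _   = partialSum-nonNegative 0≤f T
  partialSum-⊆ {f} 0≤f {π ∷ S} {T} (π∉S ∷ S!) S⊆T with ∈-∃++ (S⊆T (here ≡.refl))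
  ... | T₁ , T₂ , ≡.refl = begin
    f π + partialSum f S                        ≤⟨ +-monoʳ-≤ (f π) (partialSum-⊆ 0≤f S! S⊆T₁++T₂) ⟩
    f π + partialSum f (T₁ ++ T₂)               ≈⟨ +-congˡ (partialSum-++ f T₁ T₂) ⟩
    f π + (partialSum f T₁ + partialSum f T₂)
      ≈⟨ solve 3 (λ a s t → a :+ (s :+ t) := s :+ (a :+ t)) ≈-refl _ _ _ ⟩
    partialSum f T₁ + (f π + partialSum f T₂)   ≈⟨ partialSum-++ f T₁ (π ∷ T₂) ⟨
    partialSum f (T₁ ++ π ∷ T₂)                 ∎
    where
    open ≤-Reasoning
    S⊆T₁++T₂ : S ⊆ T₁ ++ T₂
    S⊆T₁++T₂ {ρ} ρ∈S with ∈-++⁻ T₁ (S⊆T (there ρ∈S))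
    ... | inj₁ ρ∈T₁             = ∈-++⁺ˡ ρ∈T₁
    ... | inj₂ (here ρ≡π)       = ⊥-elim (lookup π∉S ρ∈S (≡.sym ρ≡π))
    ... | inj₂ (there ρ∈T₂)     = ∈-++⁺ʳ T₁ ρ∈T₂

  -- The filter of tails of the net of finite subsets. Convergence facts become members of one
  -- filter, to be intersected by `eventually-×`.
  Eventually : (List G → Set) → Set
  Eventually P = ∃ λ (S : List G) → ∀ T → Unique T → S ⊆ T → P T

  eventually-map : ∀ {P Q} → (∀ {T} → P T → Q T) → Eventually P → Eventually Q
  eventually-map f (S , p) = S , λ T T! S⊆T → f (p T T! S⊆T)

  eventually-× : ∀ {P Q} → Eventually P → Eventually Q → Eventually (λ T → P T × Q T)
  eventually-× (S , p) (S′ , q) = S ++ S′ , λ T T! ⊆T →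
    p T T! (⊆-trans (xs⊆xs++ys S S′) ⊆T) , q T T! (⊆-trans (xs⊆ys++xs S′ S) ⊆T)

  -- The filter is proper. The threshold list may repeat entries, so it is deduplicated, with
  -- excluded middle deciding equality on `G`.
  eventually⇒∃ : ∀ {P} → Eventually P → ∃ P
  eventually⇒∃ (S , p) = deduplicate _≟_ S , p _ (deduplicate-! _≟_ S) (∈-deduplicate⁺ _≟_)
    where
    _≟_ : (π ρ : G) → _
    π ≟ ρ = em {π ≡ ρ}

  -- Two one-sided bounds replace an absolute value, so each rule below is proved once and applied
  -- in both directions.
  Within : ℝ → ℝ → ℝ → Set
  Within ε x y = x ≤ y + ε × y ≤ x + ε

  Converges : (G → ℝ) → ℝ → Set
  Converges f s = ∀ ε → 0ℝ < ε → Eventually λ T → Within ε (partialSum f T) s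

  within-cong : ∀ {ε x y x′ y′} → x ≈ x′ → y ≈ y′ → Within ε x y → Within ε x′ y′
  within-cong x≈x′ y≈y′ (p , q) =
    ≤-respˡ-≈ x≈x′ (≤-respʳ-≈ (+-congʳ y≈y′) p) , ≤-respˡ-≈ y≈y′ (≤-respʳ-≈ (+-congʳ x≈x′) q)

  within-+ : ∀ {δ ε x y u v} → δ + δ ≈ ε → Within δ x y → Within δ u v → Within ε (x + u) (y + v)
  within-+ {δ} {ε} 2δ≈ε (p , q) (p′ , q′) =
    ≤-respʳ-≈ (regroup _ _) (+-mono-≤ p p′) , ≤-respʳ-≈ (regroup _ _) (+-mono-≤ q q′)
    where
    regroup : ∀ a b → (a + δ) + (b + δ) ≈ (a + b) + ε
    regroup a b = ≈-trans
      (solve 3 (λ a b δ → (a :+ δ) :+ (b :+ δ) := (a :+ b) :+ (δ :+ δ)) ≈-refl a b δ) (+-congˡ 2δ≈ε)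

  within-neg : ∀ {ε x y} → Within ε x y → Within ε (- x) (- y)
  within-neg {ε} (p , q) = flip q , flip p
    where
    flip : ∀ {x y} → y ≤ x + ε → - x ≤ - y + ε
    flip {x} {y} le = ≤-intro (x≤y⇒0≤y-x le)
      (solve 3 (λ x y ε → :- x :+ (x :+ ε :- y) := :- y :+ ε) ≈-refl x y ε)

  within-* : ∀ {c δ ε x y} → 0ℝ ≤ c → c * δ ≤ ε → Within δ x y → Within ε (c * x) (c * y)
  within-* {c} {δ} {ε} 0≤c cδ≤ε (p , q) = scale p , scale q
    where
    open ≤-Reasoning
    scale : ∀ {x y} → x ≤ y + δ → c * x ≤ c * y + ε
    scale {x} {y} le = begin
      c * x            ≤⟨ *-monoˡ-≤ 0≤c le ⟩
      c * (y + δ)      ≈⟨ solve 3 (λ c y δ → c :* (y :+ δ) := c :* y :+ c :* δ) ≈-refl c y δ ⟩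
      c * y + c * δ    ≤⟨ +-monoʳ-≤ (c * y) cδ≤ε ⟩
      c * y + ε        ∎

  converges-cong : ∀ {f g s t} → (∀ π → f π ≈ g π) → s ≈ t → Converges f s → Converges g t
  converges-cong f≈g s≈t conv ε 0<ε =
    eventually-map (λ {T} → within-cong (partialSum-cong f≈g T) s≈t) (conv ε 0<ε)

  converges-+ : ∀ {f g s t} → Converges f s → Converges g t → Converges (λ π → f π + g π) (s + t)
  converges-+ {f} {g} convf convg ε 0<ε = eventually-map
    (λ {T} (p , q) → within-cong (≈-sym (partialSum-+ f g T)) ≈-refl (within-+ (half+half ε) p q))
    (eventually-× (convf (ε / 2ℝ) 0<ε/2) (convg (ε / 2ℝ) 0<ε/2))
    where 0<ε/2 = /-positive 0<ε 0<2

  partialSum-neg : ∀ f T → partialSum (λ π → - f π) T ≈ - partialSum f T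
  partialSum-neg f []      = solve 0 (:0 := :- :0) ≈-refl
  partialSum-neg f (π ∷ T) = ≈-trans (+-congˡ (partialSum-neg f T))
    (solve 2 (λ a s → :- a :+ :- s := :- (a :+ s)) ≈-refl (f π) (partialSum f T))

  converges-neg : ∀ {f s} → Converges f s → Converges (λ π → - f π) (- s)
  converges-neg {f} conv ε 0<ε = eventually-map
    (λ {T} w → within-cong (≈-sym (partialSum-neg f T)) ≈-refl (within-neg w)) (conv ε 0<ε)

  converges-*⁺ : ∀ {c f s} → 0ℝ ≤ c → Converges f s → Converges (λ π → c * f π) (c * s)
  converges-*⁺ {c} {f} 0≤c conv ε 0<ε = eventually-map
    (λ {T} w → within-cong (≈-sym (partialSum-* c f T)) ≈-refl (within-* 0≤c cδ≤ε w)) (conv δ 0<δ)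
    where
    0<1+c = +-positive 0<1 0≤c
    -- The summand `1ℝ` keeps the denominator positive when `c` is zero; the price is `c * δ ≤ ε` in
    -- place of equality.
    δ = ε / (1ℝ + c)
    0<δ = /-positive 0<ε 0<1+c
    cδ≤ε : c * δ ≤ ε
    cδ≤ε = ≤-intro (proj₁ 0<δ) (≈-trans
      (solve 2 (λ c δ → c :* δ :+ δ := δ :* (:1 :+ c)) ≈-refl c δ) (x/y*y≈x (positive⇒≉0 0<1+c)))

  converges-* : ∀ c {f s} → Converges f s → Converges (λ π → c * f π) (c * s)
  converges-* c {f} {s} conv with total 0ℝ c
  ... | inj₁ 0≤c = converges-*⁺ 0≤c conv
  ... | inj₂ c≤0 = converges-cong (λ π → -[-c*x] (f π)) (-[-c*x] s)
                     (converges-neg (converges-*⁺ (x≤0⇒0≤-x c≤0) conv))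
    where
    -[-c*x] : ∀ x → - (- c * x) ≈ c * x
    -[-c*x] = solve 2 (λ c x → :- (:- c :* x) := c :* x) ≈-refl c

  converges-mono : ∀ {f g s t} → (∀ π → f π ≤ g π) → Converges f s → Converges g t → s ≤ t
  converges-mono {f} {g} {s} {t} f≤g convf convg = ≤-limit bound
    where
    open ≤-Reasoning
    bound : ∀ ε → 0ℝ < ε → s ≤ t + ε
    bound ε 0<ε with eventually⇒∃ (eventually-× (convf (ε / 2ℝ) 0<ε/2) (convg (ε / 2ℝ) 0<ε/2))
      where 0<ε/2 = /-positive 0<ε 0<2
    ... | T , (_ , s≤) , (≤t , _) = begin
      s                          ≤⟨ s≤ ⟩
      partialSum f T + ε / 2ℝ    ≤⟨ +-mono-≤ (partialSum-mono f≤g T) ≤-refl ⟩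
      partialSum g T + ε / 2ℝ    ≤⟨ +-mono-≤ ≤t ≤-refl ⟩
      t + ε / 2ℝ + ε / 2ℝ        ≈⟨ solve 2 (λ t h → t :+ h :+ h := t :+ (h :+ h)) ≈-refl t (ε / 2ℝ) ⟩
      t + (ε / 2ℝ + ε / 2ℝ)      ≈⟨ +-congˡ (half+half ε) ⟩
      t + ε                      ∎

  converges-unique : ∀ {f s t} → Converges f s → Converges f t → s ≈ t
  converges-unique convs convt =
    antisym (converges-mono (λ _ → ≤-refl) convs convt) (converges-mono (λ _ → ≤-refl) convt convs)

  partialSum≤sum : ∀ {f s} → (∀ π → 0ℝ ≤ f π) → Converges f s → ∀ {T} → Unique T → partialSum f T ≤ s
  partialSum≤sum {f} {s} 0≤f conv {T} T! = ≤-limit bound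
    where
    bound : ∀ ε → 0ℝ < ε → partialSum f T ≤ s + ε
    -- Intersecting with the tail above `T` makes the chosen `T′` contain `T`, so its partial sum
    -- dominates that of `T`.
    bound ε 0<ε with eventually⇒∃ (eventually-× {Q = T ⊆_} (conv ε 0<ε) (T , λ _ _ T⊆T′ → T⊆T′))
    ... | T′ , (≤s+ε , _) , T⊆T′ = ≤-trans (partialSum-⊆ 0≤f T! T⊆T′) ≤s+ε

  sum-nonNegative : ∀ {f s} → (∀ π → 0ℝ ≤ f π) → Converges f s → 0ℝ ≤ s
  sum-nonNegative 0≤f conv = partialSum≤sum 0≤f conv []

  -- Monotone convergence, and the one use of Dedekind completeness: the sum is the supremum of the
  -- partial sums. If none of them came within `ε` of it, `s - ε` would be a smaller upper bound.
  bounded⇒converges : ∀ {f b} → (∀ π → 0ℝ ≤ f π) → (∀ T → Unique T → partialSum f T ≤ b) →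
                      ∃ (Converges f)
  bounded⇒converges {f} {b} 0≤f bounded = s , converges
    where
    IsPartialSum : ℝ → Set
    IsPartialSum x = ∃ λ T → Unique T × x ≈ partialSum f T
    sup = supremum IsPartialSum (0ℝ , [] , [] , ≈-refl)
            (b , λ { x (T , T! , x≈) → ≤-respˡ-≈ (≈-sym x≈) (bounded T T!) })
    s = proj₁ sup
    ≤s : ∀ T → Unique T → partialSum f T ≤ s
    ≤s T T! = proj₁ (proj₂ sup) _ (T , T! , ≈-refl)
    converges : Converges f s
    converges ε 0<ε with em {∃ λ T → Unique T × s ≤ partialSum f T + ε}
    ... | yes (S , S! , s≤) = S , λ T T! S⊆T →
      ≤-trans (≤s T T!) (≤-intro (proj₁ 0<ε) ≈-refl) ,
      ≤-trans s≤ (+-mono-≤ (partialSum-⊆ 0≤f S! S⊆T) ≤-refl)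
    ... | no ∄T = ⊥-elim (positive⇒≉0 0<ε (antisym ε≤0 (proj₁ 0<ε)))
      where
      upper : UpperBound IsPartialSum (s - ε)
      upper x (T , T! , x≈) with total x (s - ε)
      ... | inj₁ x≤ = x≤
      ... | inj₂ ≤x = ⊥-elim (∄T (T , T! , ≤-intro (x≤y⇒0≤y-x (≤-respʳ-≈ x≈ ≤x))
              (solve 3 (λ s p ε → s :+ (p :- (s :- ε)) := p :+ ε) ≈-refl s (partialSum f T) ε)))
      ε≤0 : ε ≤ 0ℝ
      ε≤0 = ≤-intro (x≤y⇒0≤y-x (proj₂ (proj₂ sup) (s - ε) upper))
        (solve 2 (λ s ε → ε :+ (s :- ε :- s) := :0) ≈-refl s ε)

  -- f + g lies between 0 and 2g, so its partial sums are bounded.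
  dominated⇒converges : ∀ {f g t} → (∀ π → - g π ≤ f π) → (∀ π → f π ≤ g π) → Converges g t →
                        ∃ (Converges f)
  dominated⇒converges {f} {g} {t} -g≤f f≤g convg =
    s - t , converges-cong (λ π → solve 2 (λ a b → (a :+ b) :+ :- b := a) ≈-refl (f π) (g π)) ≈-refl
              (converges-+ (proj₂ conv) (converges-neg convg))
    where
    0≤f+g : ∀ π → 0ℝ ≤ f π + g π
    0≤f+g π = ≤-respʳ-≈ (solve 2 (λ a b → a :- :- b := a :+ b) ≈-refl (f π) (g π)) (x≤y⇒0≤y-x (-g≤f π))
    f+g≤2g : ∀ π → f π + g π ≤ g π + g π
    f+g≤2g π = +-mono-≤ (f≤g π) ≤-refl
    0≤2g : ∀ π → 0ℝ ≤ g π + g π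
    0≤2g π = ≤-trans (0≤f+g π) (f+g≤2g π)
    conv = bounded⇒converges 0≤f+g λ T T! →
      ≤-trans (partialSum-mono f+g≤2g T) (partialSum≤sum 0≤2g (converges-+ convg convg) T!)
    s = proj₁ conv

-- Complex polynomial syntax for the real ring solver.

module ComplexPolynomials (em : ExcludedMiddle 0ℓ) (𝓡 : RealNumbers) where

  open OrderedField em 𝓡

  infixl 6 _:+ᶜ_ _:-ᶜ_
  infixl 7 _:*ᶜ_

  -- A pair of real polynomials. The operations copy those of `ℂ` clause by clause, so an evaluated
  -- identity is definitionally the intended complex one and `≈-refl` closes it.
  Polynomialᶜ : ℕ → Set
  Polynomialᶜ n = Polynomial n × Polynomial n

  _:+ᶜ_ _:-ᶜ_ _:*ᶜ_ : ∀ {n} → Polynomialᶜ n → Polynomialᶜ n → Polynomialᶜ n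
  (a , b) :+ᶜ (c , d) = a :+ c , b :+ d
  (a , b) :-ᶜ (c , d) = a :- c , b :- d
  (a , b) :*ᶜ (c , d) = a :* c :- b :* d , a :* d :+ b :* c

  :conj : ∀ {n} → Polynomialᶜ n → Polynomialᶜ n
  :conj (a , b) = a , :- b

  :ofReal : ∀ {n} → Polynomial n → Polynomialᶜ n
  :ofReal a = a , :0

  :re :im :∣_∣² : ∀ {n} → Polynomialᶜ n → Polynomial n
  :re (a , b) = a
  :im (a , b) = b
  :∣ a , b ∣² = a :* a :+ b :* b

  :2 : ∀ {n} → Polynomial n
  :2 = :1 :+ :1

-- Complex series through real and imaginary parts.

module ComplexSeries (em : ExcludedMiddle 0ℓ) (𝓡 : RealNumbers) {G : Set} where

  open Analysis em 𝓡
  open OrderedField em 𝓡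
  open RealSeries em 𝓡 {G}

  Convergesᶜ : (G → ℂ) → ℂ → Set
  Convergesᶜ f s = Converges (λ π → re (f π)) (re s) × Converges (λ π → im (f π)) (im s)

  re-finiteSum : ∀ f T → re (finiteSum f T) ≡ partialSum (λ π → re (f π)) T
  re-finiteSum f []      = ≡.refl
  re-finiteSum f (π ∷ T) = ≡.cong (re (f π) +_) (re-finiteSum f T)

  im-finiteSum : ∀ f T → im (finiteSum f T) ≡ partialSum (λ π → im (f π)) T
  im-finiteSum f []      = ≡.refl
  im-finiteSum f (π ∷ T) = ≡.cong (im (f π) +_) (im-finiteSum f T)

  square-cancel-≤ : ∀ {x ε} → 0ℝ < ε → x * x ≤ ε * ε → x ≤ ε
  square-cancel-≤ {x} {ε} 0<ε x²≤ε² with total 0ℝ x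
  ... | inj₂ x≤0 = ≤-trans x≤0 (proj₁ 0<ε)
  ... | inj₁ 0≤x = 0≤y-x⇒x≤y (*-cancelʳ-nonNegative (+-positive 0<ε 0≤x)
    (≤-respʳ-≈ (solve 2 (λ x ε → ε :* ε :- x :* x := (ε :- x) :* (ε :+ x)) ≈-refl x ε)
      (x≤y⇒0≤y-x x²≤ε²)))

  square≤⇒within : ∀ {x y ε} → 0ℝ < ε → (x - y) * (x - y) ≤ ε * ε → Within ε x y
  square≤⇒within {x} {y} {ε} 0<ε le =
    shift (square-cancel-≤ 0<ε le) ,
    shift (square-cancel-≤ 0<ε (≤-respˡ-≈
      (solve 2 (λ x y → (x :- y) :* (x :- y) := (y :- x) :* (y :- x)) ≈-refl x y) le))
    where
    shift : ∀ {x y} → x - y ≤ ε → x ≤ y + ε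
    shift {x} {y} p = ≤-intro (x≤y⇒0≤y-x p)
      (solve 3 (λ x y ε → x :+ (ε :- (x :- y)) := y :+ ε) ≈-refl x y ε)

  -- The difference `ε² - (x - y)²` factors into the two slacks of `Within`.
  within⇒square≤ : ∀ {x y ε} → Within ε x y → (x - y) * (x - y) ≤ ε * ε
  within⇒square≤ {x} {y} {ε} (p , q) = ≤-intro (*-nonNegative (x≤y⇒0≤y-x p) (x≤y⇒0≤y-x q))
    (solve 3 (λ x y ε → (x :- y) :* (x :- y) :+ (y :+ ε :- x) :* (x :+ ε :- y) := ε :* ε) ≈-refl x y ε)

  hasSum⇒converges : ∀ {f s} → HasSum f s → Convergesᶜ f s
  hasSum⇒converges {f} {s} sum =
    (λ ε 0<ε → eventually-map (λ {T} lt → within-cong (≈-reflexive (re-finiteSum f T)) ≈-refl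
      (square≤⇒within 0<ε (≤-trans (≤-intro (square-nonNegative _) ≈-refl) (proj₁ lt)))) (sum ε 0<ε)) ,
    (λ ε 0<ε → eventually-map (λ {T} lt → within-cong (≈-reflexive (im-finiteSum f T)) ≈-refl
      (square≤⇒within 0<ε (≤-trans (≤-intro (square-nonNegative _) (+-comm _ _)) (proj₁ lt)))) (sum ε 0<ε))

  converges⇒hasSum : ∀ {f s} → Convergesᶜ f s → HasSum f s
  converges⇒hasSum {f} {s} (conv-re , conv-im) ε 0<ε = eventually-map
    (λ {T} (p , q) → ≤-<-trans (+-mono-≤
        (within⇒square≤ (within-cong (≈-reflexive (≡.sym (re-finiteSum f T))) ≈-refl p))
        (within⇒square≤ (within-cong (≈-reflexive (≡.sym (im-finiteSum f T))) ≈-refl q))) 2δ²<ε²)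
    (eventually-× (conv-re δ 0<δ) (conv-im δ 0<δ))
    where
    -- Two coordinates within `ε / 2` give at most `ε² / 2`, strictly below `ε²` as `HasSum`
    -- demands, and no square root of 2 is involved.
    δ = ε / 2ℝ
    0<δ = /-positive 0<ε 0<2
    0<δ² = *-positive 0<δ 0<δ
    ≤-<-trans : ∀ {x y z} → x ≤ y → y < z → x < z
    ≤-<-trans x≤y (y≤z , y≉z) =
      ≤-trans x≤y y≤z , λ x≈z → y≉z (antisym y≤z (≤-respˡ-≈ x≈z x≤y))
    2δ²<ε² : δ * δ + δ * δ < ε * ε
    2δ²<ε² = ≤-intro (proj₁ (+-positive 0<δ² (proj₁ 0<δ²))) 4δ²≈ε² ,
      λ eq → positive⇒≉0 (+-positive 0<δ² (proj₁ 0<δ²)) (double≈self (≈-trans 4δ²≈ε² (≈-sym eq)))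
      where
      4δ²≈ε² : (δ * δ + δ * δ) + (δ * δ + δ * δ) ≈ ε * ε
      4δ²≈ε² = ≈-trans
        (solve 1 (λ δ → (δ :* δ :+ δ :* δ) :+ (δ :* δ :+ δ :* δ) := (δ :+ δ) :* (δ :+ δ)) ≈-refl δ)
        (*-cong (half+half ε) (half+half ε))
      double≈self : ∀ {x} → x + x ≈ x → x ≈ 0ℝ
      double≈self {x} eq = ≈-trans (solve 1 (λ x → x := (x :+ x) :- x) ≈-refl x)
        (≈-trans (+-congʳ eq) (-‿inverseʳ x))

  -- Uniqueness of limits ties the chosen value of `∑` to any limit exhibited. Nothing later has to
  -- look at the zero convention for divergent series.
  converges⇒∑ : ∀ {f s} → Convergesᶜ f s → ∑ f ≈ᶜ s
  converges⇒∑ {f} {s} conv@(conv-re , conv-im) with em {Summable f}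
  ... | yes (t , sum) = converges-unique (proj₁ (hasSum⇒converges sum)) conv-re ,
                        converges-unique (proj₂ (hasSum⇒converges sum)) conv-im
  ... | no ¬sum = ⊥-elim (¬sum (s , converges⇒hasSum conv))

-- Weighted means, square integrability and the variance inequality.

module Means (em : ExcludedMiddle 0ℓ) (𝓡 : RealNumbers) where

  open Analysis em 𝓡
  open OrderedField em 𝓡
  open ComplexPolynomials em 𝓡

  module WeightedMeans {G : Set} (L : G → ℂ) (w : G → ℝ) (w≥0 : ∀ π → 0ℝ ≤ w π)
    (w≢0 : ¬ (∀ π → w π ≈ 0ℝ)) (w-summable : Summable (λ π → ofReal (w π))) where

    open RealSeries em 𝓡 {G}
    open ComplexSeries em 𝓡 {G}
    open Weighted L w using (𝔼)

    totalWeight : ℝ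
    totalWeight = re (proj₁ w-summable)

    w-converges : Converges w totalWeight
    w-converges = proj₁ (hasSum⇒converges (proj₂ w-summable))

    ∑w≈totalWeight : ∑ (λ π → ofReal (w π)) ≈ᶜ ofReal totalWeight
    ∑w≈totalWeight = converges⇒∑
      ( w-converges
      -- The imaginary parts are the zero family; scaling an already convergent series by `0ℝ` shows
      -- that its sum is zero.
      , converges-cong (λ _ → zeroˡ 0ℝ) (zeroˡ _)
          (converges-* 0ℝ (proj₂ (hasSum⇒converges (proj₂ w-summable)))))

    -- Excluded middle extracts a point of nonzero weight from `w≢0`; the partial sum over that
    -- single point already bounds the total from below.
    totalWeight-positive : 0ℝ < totalWeight
    totalWeight-positive with em {∃ λ π → ¬ (w π ≈ 0ℝ)}
    ... | yes (π , wπ≉0) = <-≤-trans (nonNegative∧≉0⇒positive (w≥0 π) wπ≉0)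
            (≤-respˡ-≈ (+-identityʳ (w π)) (partialSum≤sum w≥0 w-converges {π ∷ []} ([] ∷ [])))
    ... | no ∄π = ⊥-elim (w≢0 w≈0)
      where
      w≈0 : ∀ π → w π ≈ 0ℝ
      w≈0 π with em {w π ≈ 0ℝ}
      ... | yes wπ≈0 = wπ≈0
      ... | no wπ≉0  = ⊥-elim (∄π (π , wπ≉0))

    -- A relation, so it also asserts convergence, which a value of `𝔼` does not. The normalisation
    -- is multiplied out, so the linear rules involve no division.
    HasMean : (G → ℝ) → ℝ → Set
    HasMean f m = Converges (λ π → w π * f π) (m * totalWeight)

    HasMeanᶜ : (G → ℂ) → ℂ → Set
    HasMeanᶜ f m = HasMean (λ π → re (f π)) (re m) × HasMean (λ π → im (f π)) (im m)

    converges⇒hasMean : ∀ {f s} → Converges (λ π → w π * f π) s → HasMean f (s / totalWeight)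
    converges⇒hasMean = converges-cong (λ _ → ≈-refl) (≈-sym (x/y*y≈x (positive⇒≉0 totalWeight-positive)))

    mean-cong : ∀ {f g m n} → (∀ π → f π ≈ g π) → m ≈ n → HasMean f m → HasMean g n
    mean-cong f≈g m≈n = converges-cong (λ π → *-congˡ (f≈g π)) (*-congʳ m≈n)

    mean-+ : ∀ {f g m n} → HasMean f m → HasMean g n → HasMean (λ π → f π + g π) (m + n)
    mean-+ {f} {g} p q = converges-cong
      (λ π → solve 3 (λ w a b → w :* a :+ w :* b := w :* (a :+ b)) ≈-refl (w π) (f π) (g π))
      (solve 3 (λ w a b → a :* w :+ b :* w := (a :+ b) :* w) ≈-refl totalWeight _ _)
      (converges-+ p q)

    mean-* : ∀ c {f m} → HasMean f m → HasMean (λ π → c * f π) (c * m)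
    mean-* c {f} {m} p = converges-cong
      (λ π → solve 3 (λ c w a → c :* (w :* a) := w :* (c :* a)) ≈-refl c (w π) (f π))
      (≈-sym (*-assoc c m totalWeight)) (converges-* c p)

    mean-const : ∀ c → HasMean (λ _ → c) c
    mean-const c = converges-cong (λ π → *-comm c (w π)) ≈-refl (converges-* c w-converges)

    mean-nonNegative : ∀ {f m} → (∀ π → 0ℝ ≤ f π) → HasMean f m → 0ℝ ≤ m
    mean-nonNegative 0≤f p = *-cancelʳ-nonNegative totalWeight-positive
      (sum-nonNegative (λ π → *-nonNegative (w≥0 π) (0≤f π)) p)

    dominated⇒hasMean : ∀ {f g n} → (∀ π → 0ℝ ≤ g π + f π) → (∀ π → 0ℝ ≤ g π - f π) → HasMean g n →
                        ∃ (HasMean f)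
    dominated⇒hasMean {f} {g} 0≤g+f 0≤g-f p = _ , converges⇒hasMean (proj₂ (dominated⇒converges
      (λ π → ≤-intro (*-nonNegative (w≥0 π) (0≤g+f π))
        (solve 3 (λ w f g → :- (w :* g) :+ w :* (g :+ f) := w :* f) ≈-refl (w π) (f π) (g π)))
      (λ π → *-monoˡ-≤ (w≥0 π) (0≤y-x⇒x≤y (0≤g-f π)))
      p))

    -- The complex quotient multiplies by `conj W` and divides by `∣ W ∣²`. Up to `≈ᶜ`, `W` is the
    -- real `T`: the divisor is `T * T`, one factor from `conj W` and one from `HasMean`.
    hasMean⇒𝔼 : ∀ {f m} → HasMeanᶜ f m → 𝔼 f ≈ᶜ m
    hasMean⇒𝔼 {f} {m} (mean-re , mean-im) =
      /-unique |W|²≉0 (begin-equality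
        re m * ∣ W ∣²                            ≈⟨ *-congˡ |W|²≈T² ⟩
        re m * (T * T)
          ≈⟨ solve 3 (λ x y t → x :* (t :* t) := x :* t :* t :- y :* t :* :- :0) ≈-refl (re m) (im m) T ⟩
        re m * T * T - im m * T * - 0ℝ
          ≈⟨ +-cong (*-cong reΣ reW) (-‿cong (*-cong imΣ (-‿cong imW))) ⟨
        re (Σf *ᶜ conj W)                        ∎) ,
      /-unique |W|²≉0 (begin-equality
        im m * ∣ W ∣²                            ≈⟨ *-congˡ |W|²≈T² ⟩
        im m * (T * T)
          ≈⟨ solve 3 (λ x y t → y :* (t :* t) := x :* t :* :- :0 :+ y :* t :* t) ≈-refl (re m) (im m) T ⟩
        re m * T * - 0ℝ + im m * T * T           ≈⟨ +-cong (*-cong reΣ (-‿cong imW)) (*-cong imΣ reW) ⟨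
        im (Σf *ᶜ conj W)                        ∎)
      where
      open ≤-Reasoning
      T = totalWeight
      W = ∑ (λ π → ofReal (w π))
      Σf = ∑ (λ π → ofReal (w π) *ᶜ f π)
      reW = proj₁ ∑w≈totalWeight
      imW = proj₂ ∑w≈totalWeight
      Σf≈ : Σf ≈ᶜ (re m * T +i im m * T)
      Σf≈ = converges⇒∑
        ( converges-cong (λ π → solve 3 (λ w x y → w :* x := w :* x :- :0 :* y)
              ≈-refl (w π) (re (f π)) (im (f π)))
            ≈-refl mean-re
        , converges-cong (λ π → solve 3 (λ w x y → w :* y := w :* y :+ :0 :* x)
              ≈-refl (w π) (re (f π)) (im (f π)))
            ≈-refl mean-im)
      reΣ = proj₁ Σf≈
      imΣ = proj₂ Σf≈
      |W|²≈T² : ∣ W ∣² ≈ T * T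
      |W|²≈T² = ≈-trans (+-cong (*-cong reW reW) (*-cong imW imW))
        (solve 1 (λ t → t :* t :+ :0 :* :0 := t :* t) ≈-refl T)
      |W|²≉0 : ¬ (∣ W ∣² ≈ 0ℝ)
      |W|²≉0 eq = positive⇒≉0 (*-positive totalWeight-positive totalWeight-positive)
        (≈-trans (≈-sym |W|²≈T²) eq)

    SquareIntegrable : (G → ℂ) → Set
    SquareIntegrable u = ∃ (HasMean (λ π → ∣ u π ∣²))

    -- Twice the expression is a sum of three squared moduli, those of `z`, of `s +i t` and of their
    -- sum.
    dot-bound : ∀ z s t → 0ℝ ≤ ∣ z ∣² + (s * s + t * t) + (re z * s + im z * t)
    dot-bound z s t = *-cancelʳ-nonNegative 0<2 (≤-respʳ-≈
      (solve 4 (λ x y s t →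
          (:∣ x , y ∣² :+ :∣ s , t ∣²) :+ :∣ x :+ s , y :+ t ∣²
          := (:∣ x , y ∣² :+ :∣ s , t ∣² :+ (x :* s :+ y :* t)) :* :2)
        ≈-refl (re z) (im z) s t)
      (+-nonNegative (+-nonNegative (∣∣²-nonNegative z) (∣∣²-nonNegative (s +i t)))
        (∣∣²-nonNegative (z +ᶜ (s +i t)))))

    -- ± Re (u v̄) and ± Im (u v̄) are real dot products of u with ± v and ± i v, hence
    -- dominated by |u|² + |v|².
    innerProduct-exists : ∀ {u v} → SquareIntegrable u → SquareIntegrable v →
                          ∃ (HasMeanᶜ (λ π → u π *ᶜ conj (v π)))
    innerProduct-exists {u} {v} (_ , mean-u) (_ , mean-v) =
      (proj₁ mean-re +i proj₁ mean-im) , proj₂ mean-re , proj₂ mean-im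
      where
      mean-re = dominated⇒hasMean
        (λ π → ≤-respʳ-≈ (solve 4 (λ a b c d →
            :∣ a , b ∣² :+ :∣ c , d ∣² :+ (a :* c :+ b :* d)
            := :∣ a , b ∣² :+ :∣ c , d ∣² :+ :re ((a , b) :*ᶜ :conj (c , d)))
            ≈-refl (re (u π)) (im (u π)) (re (v π)) (im (v π)))
          (dot-bound (u π) (re (v π)) (im (v π))))
        (λ π → ≤-respʳ-≈ (solve 4 (λ a b c d →
            :∣ a , b ∣² :+ :∣ :- c , :- d ∣² :+ (a :* :- c :+ b :* :- d)
            := :∣ a , b ∣² :+ :∣ c , d ∣² :- :re ((a , b) :*ᶜ :conj (c , d)))
            ≈-refl (re (u π)) (im (u π)) (re (v π)) (im (v π)))
          (dot-bound (u π) (- re (v π)) (- im (v π))))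
        (mean-+ mean-u mean-v)
      mean-im = dominated⇒hasMean
        (λ π → ≤-respʳ-≈ (solve 4 (λ a b c d →
            :∣ a , b ∣² :+ :∣ :- d , c ∣² :+ (a :* :- d :+ b :* c)
            := :∣ a , b ∣² :+ :∣ c , d ∣² :+ :im ((a , b) :*ᶜ :conj (c , d)))
            ≈-refl (re (u π)) (im (u π)) (re (v π)) (im (v π)))
          (dot-bound (u π) (- im (v π)) (re (v π))))
        (λ π → ≤-respʳ-≈ (solve 4 (λ a b c d →
            :∣ a , b ∣² :+ :∣ d , :- c ∣² :+ (a :* d :+ b :* :- c)
            := :∣ a , b ∣² :+ :∣ c , d ∣² :- :im ((a , b) :*ᶜ :conj (c , d)))
            ≈-refl (re (u π)) (im (u π)) (re (v π)) (im (v π)))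
          (dot-bound (u π) (im (v π)) (- re (v π))))
        (mean-+ mean-u mean-v)

    -- Since the total weight is finite, the constant 1 is square integrable, and the mean of `u` is
    -- the inner product with it.
    mean-exists : ∀ {u} → SquareIntegrable u → ∃ (HasMeanᶜ u)
    mean-exists {u} sq =
      let (m , mean-re , mean-im) = innerProduct-exists {v = λ _ → ofReal 1ℝ} sq (_ , mean-const _) in
      m , mean-cong (λ π → solve 2 (λ x y → x :* :1 :- y :* :- :0 := x)
            ≈-refl (re (u π)) (im (u π))) ≈-refl mean-re
        , mean-cong (λ π → solve 2 (λ x y → x :* :- :0 :+ y :* :1 := y)
            ≈-refl (re (u π)) (im (u π))) ≈-refl mean-im

    ∣mean∣²≤meanSquare : ∀ {u m s} → HasMeanᶜ u m → HasMean (λ π → ∣ u π ∣²) s → ∣ m ∣² ≤ s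
    ∣mean∣²≤meanSquare {u} {m} {s} (mean-re , mean-im) mean-sq =
      ≤-intro (mean-nonNegative (λ π → ∣∣²-nonNegative (u π -ᶜ m)) variance)
        (solve 3 (λ s x y → (x :* x :+ y :* y) :+ (s :- (x :* x :+ y :* y)) := s) ≈-refl s (re m) (im m))
      where
      -- For fixed `m`, `∣ u - m ∣²` is a real combination of `∣ u ∣²`, `re u`, `im u` and a
      -- constant; the cross terms contribute `-2 ∣ m ∣²`, the constant `∣ m ∣²`.
      variance : HasMean (λ π → ∣ u π -ᶜ m ∣²) (s - ∣ m ∣²)
      variance = mean-cong
        (λ π → solve 4 (λ a b x y →
            (a :* a :+ b :* b) :+ (:- (:2 :* x) :* a :+ (:- (:2 :* y) :* b :+ (x :* x :+ y :* y)))
            := (a :- x) :* (a :- x) :+ (b :- y) :* (b :- y))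
          ≈-refl (re (u π)) (im (u π)) (re m) (im m))
        (solve 3 (λ s x y → s :+ (:- (:2 :* x) :* x :+ (:- (:2 :* y) :* y :+ (x :* x :+ y :* y)))
                  := s :- (x :* x :+ y :* y)) ≈-refl s (re m) (im m))
        (mean-+ mean-sq (mean-+ (mean-* (- (2ℝ * re m)) mean-re)
          (mean-+ (mean-* (- (2ℝ * im m)) mean-im) (mean-const ∣ m ∣²))))

    module _ {u v : G → ℂ} {p q C : ℂ} {A B : ℝ}
      (mean-u : HasMeanᶜ u p) (mean-v : HasMeanᶜ v q)
      (square-u : HasMean (λ π → ∣ u π ∣²) A) (square-v : HasMean (λ π → ∣ v π ∣²) B)
      (inner-uv : HasMeanᶜ (λ π → u π *ᶜ conj (v π)) C) (x y : ℂ) where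

      combination-mean : HasMeanᶜ (λ π → x *ᶜ u π +ᶜ y *ᶜ v π) (x *ᶜ p +ᶜ y *ᶜ q)
      combination-mean =
        mean-cong (λ π → re-eq (u π) (v π)) (re-eq p q)
          (mean-+ (mean-* (re x) (proj₁ mean-u)) (mean-+ (mean-* (- im x) (proj₂ mean-u))
            (mean-+ (mean-* (re y) (proj₁ mean-v)) (mean-* (- im y) (proj₂ mean-v))))) ,
        mean-cong (λ π → im-eq (u π) (v π)) (im-eq p q)
          (mean-+ (mean-* (re x) (proj₂ mean-u)) (mean-+ (mean-* (im x) (proj₁ mean-u))
            (mean-+ (mean-* (re y) (proj₂ mean-v)) (mean-* (im y) (proj₁ mean-v)))))
        where
        re-eq : ∀ z t → re x * re z + (- im x * im z + (re y * re t + - im y * im t))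
                        ≈ re (x *ᶜ z +ᶜ y *ᶜ t)
        re-eq z t = solve 8 (λ x₁ x₂ y₁ y₂ z₁ z₂ t₁ t₂ →
            x₁ :* z₁ :+ (:- x₂ :* z₂ :+ (y₁ :* t₁ :+ :- y₂ :* t₂))
            := :re ((x₁ , x₂) :*ᶜ (z₁ , z₂) :+ᶜ (y₁ , y₂) :*ᶜ (t₁ , t₂)))
          ≈-refl (re x) (im x) (re y) (im y) (re z) (im z) (re t) (im t)
        im-eq : ∀ z t → re x * im z + (im x * re z + (re y * im t + im y * re t))
                        ≈ im (x *ᶜ z +ᶜ y *ᶜ t)
        im-eq z t = solve 8 (λ x₁ x₂ y₁ y₂ z₁ z₂ t₁ t₂ →
            x₁ :* z₂ :+ (x₂ :* z₁ :+ (y₁ :* t₂ :+ y₂ :* t₁))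
            := :im ((x₁ , x₂) :*ᶜ (z₁ , z₂) :+ᶜ (y₁ , y₂) :*ᶜ (t₁ , t₂)))
          ≈-refl (re x) (im x) (re y) (im y) (re z) (im z) (re t) (im t)

      -- The rules for `HasMean` are linear over the reals only, so the cross term `2 Re(x ȳ u v̄)`
      -- is split into `2 Re(x ȳ) Re(u v̄)` and `-2 Im(x ȳ) Im(u v̄)`.
      combination-square : HasMean (λ π → ∣ x *ᶜ u π +ᶜ y *ᶜ v π ∣²)
        (∣ x ∣² * A + ∣ y ∣² * B + 2ℝ * re (x *ᶜ conj y *ᶜ C))
      combination-square = mean-cong
        (λ π → solve 8 (λ x₁ x₂ y₁ y₂ u₁ u₂ v₁ v₂ →
            let x = x₁ , x₂; y = y₁ , y₂; u = u₁ , u₂; v = v₁ , v₂ in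
            (:∣ x ∣² :* :∣ u ∣² :+ :∣ y ∣² :* :∣ v ∣²)
              :+ ((:2 :* :re (x :*ᶜ :conj y)) :* :re (u :*ᶜ :conj v)
                  :+ (:- (:2 :* :im (x :*ᶜ :conj y))) :* :im (u :*ᶜ :conj v))
            := :∣ x :*ᶜ u :+ᶜ y :*ᶜ v ∣²)
          ≈-refl (re x) (im x) (re y) (im y) (re (u π)) (im (u π)) (re (v π)) (im (v π)))
        (solve 8 (λ x₁ x₂ y₁ y₂ A B C₁ C₂ →
            let x = x₁ , x₂; y = y₁ , y₂; C = C₁ , C₂ in
            (:∣ x ∣² :* A :+ :∣ y ∣² :* B)
              :+ ((:2 :* :re (x :*ᶜ :conj y)) :* C₁ :+ (:- (:2 :* :im (x :*ᶜ :conj y))) :* C₂)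
            := :∣ x ∣² :* A :+ :∣ y ∣² :* B :+ :2 :* :re (x :*ᶜ :conj y :*ᶜ C))
          ≈-refl (re x) (im x) (re y) (im y) A B (re C) (im C))
        (mean-+ (mean-+ (mean-* ∣ x ∣² square-u) (mean-* ∣ y ∣² square-v))
          (mean-+ (mean-* (2ℝ * re (x *ᶜ conj y)) (proj₁ inner-uv))
                  (mean-* (- (2ℝ * im (x *ᶜ conj y))) (proj₂ inner-uv))))

      -- Positive semidefiniteness of the covariance matrix of `u` and `v`, written as a form in `x`
      -- and `y`.
      gram-inequality : ∣ x *ᶜ p +ᶜ y *ᶜ q ∣²
                        ≤ ∣ x ∣² * A + ∣ y ∣² * B + 2ℝ * re (x *ᶜ conj y *ᶜ C)
      gram-inequality = ∣mean∣²≤meanSquare combination-mean combination-square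

-- Arithmetic of complex numbers up to `≈ᶜ`.

module ComplexNumbers (em : ExcludedMiddle 0ℓ) (𝓡 : RealNumbers) where

  open Analysis em 𝓡
  open OrderedField em 𝓡
  open ComplexPolynomials em 𝓡

  ≈ᶜ-refl : ∀ {z} → z ≈ᶜ z
  ≈ᶜ-refl = ≈-refl , ≈-refl

  ≈ᶜ-sym : ∀ {z u} → z ≈ᶜ u → u ≈ᶜ z
  ≈ᶜ-sym (p , q) = ≈-sym p , ≈-sym q

  ≈ᶜ-trans : ∀ {z u v} → z ≈ᶜ u → u ≈ᶜ v → z ≈ᶜ v
  ≈ᶜ-trans (p , q) (p′ , q′) = ≈-trans p p′ , ≈-trans q q′

  -ᶜ-cong : ∀ {z z′ u u′} → z ≈ᶜ z′ → u ≈ᶜ u′ → z -ᶜ u ≈ᶜ z′ -ᶜ u′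
  -ᶜ-cong (p , q) (p′ , q′) = +-cong p (-‿cong p′) , +-cong q (-‿cong q′)

  +ᶜ-cong : ∀ {z z′ u u′} → z ≈ᶜ z′ → u ≈ᶜ u′ → z +ᶜ u ≈ᶜ z′ +ᶜ u′
  +ᶜ-cong (p , q) (p′ , q′) = +-cong p p′ , +-cong q q′

  *ᶜ-cong : ∀ {z z′ u u′} → z ≈ᶜ z′ → u ≈ᶜ u′ → z *ᶜ u ≈ᶜ z′ *ᶜ u′
  *ᶜ-cong (p , q) (p′ , q′) =
    +-cong (*-cong p p′) (-‿cong (*-cong q q′)) , +-cong (*-cong p q′) (*-cong q p′)

  ∣∣²-cong : ∀ {z u} → z ≈ᶜ u → ∣ z ∣² ≈ ∣ u ∣²
  ∣∣²-cong (p , q) = +-cong (*-cong p p) (*-cong q q)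

  ∣∣²-* : ∀ z u → ∣ z *ᶜ u ∣² ≈ ∣ z ∣² * ∣ u ∣²
  ∣∣²-* z u = solve 4 (λ z₁ z₂ u₁ u₂ →
      :∣ (z₁ , z₂) :*ᶜ (u₁ , u₂) ∣² := :∣ z₁ , z₂ ∣² :* :∣ u₁ , u₂ ∣²)
    ≈-refl (re z) (im z) (re u) (im u)

  square≈0⇒≈0 : ∀ {x} → x * x ≈ 0ℝ → x ≈ 0ℝ
  square≈0⇒≈0 {x} x²≈0 with em {x ≈ 0ℝ}
  ... | yes x≈0 = x≈0
  ... | no  x≉0 = x*y≈0⇒x≈0 x²≈0 x≉0

  ∣z∣²≈0⇒z≈0 : ∀ {z} → ∣ z ∣² ≈ 0ℝ → z ≈ᶜ 0ᶜ
  ∣z∣²≈0⇒z≈0 {z} eq =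
    square≈0⇒≈0 (antisym (≤-intro (square-nonNegative (im z)) eq) (square-nonNegative (re z))) ,
    square≈0⇒≈0 (antisym (≤-intro (square-nonNegative (re z)) (≈-trans (+-comm _ _) eq))
                          (square-nonNegative (im z)))

  z-u≈0⇒z≈u : ∀ {z u} → z -ᶜ u ≈ᶜ 0ᶜ → z ≈ᶜ u
  z-u≈0⇒z≈u {z} {u} (p , q) = lemma p , lemma q
    where
    lemma : ∀ {x y} → x - y ≈ 0ℝ → x ≈ y
    lemma {x} {y} eq = ≈-trans (solve 2 (λ x y → x := (x :- y) :+ y) ≈-refl x y)
      (≈-trans (+-congʳ eq) (+-identityˡ y))

  z/u*u≈z : ∀ {z u} → ¬ (∣ u ∣² ≈ 0ℝ) → (z /ᶜ u) *ᶜ u ≈ᶜ z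
  z/u*u≈z {z} {u} |u|²≉0 =
    *-cancelʳ-≈ |u|²≉0 (begin-equality
      (r / n * re u - i / n * im u) * n
        ≈⟨ solve 5 (λ r i a b n → (r :* a :- i :* b) :* n := (r :* n) :* a :- (i :* n) :* b)
           ≈-refl (r / n) (i / n) (re u) (im u) n ⟩
      r / n * n * re u - i / n * n * im u
        ≈⟨ +-cong (*-congʳ (x/y*y≈x |u|²≉0)) (-‿cong (*-congʳ (x/y*y≈x |u|²≉0))) ⟩
      r * re u - i * im u                    ≈⟨ solve 4 (λ z₁ z₂ u₁ u₂ →
            let z = z₁ , z₂; u = u₁ , u₂ in :re ((z :*ᶜ :conj u) :*ᶜ u) := z₁ :* :∣ u ∣²)
          ≈-refl (re z) (im z) (re u) (im u) ⟩
      re z * n                               ∎) ,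
    *-cancelʳ-≈ |u|²≉0 (begin-equality
      (r / n * im u + i / n * re u) * n
        ≈⟨ solve 5 (λ r i a b n → (r :* b :+ i :* a) :* n := (r :* n) :* b :+ (i :* n) :* a)
           ≈-refl (r / n) (i / n) (re u) (im u) n ⟩
      r / n * n * im u + i / n * n * re u
        ≈⟨ +-cong (*-congʳ (x/y*y≈x |u|²≉0)) (*-congʳ (x/y*y≈x |u|²≉0)) ⟩
      r * im u + i * re u                    ≈⟨ solve 4 (λ z₁ z₂ u₁ u₂ →
            let z = z₁ , z₂; u = u₁ , u₂ in :im ((z :*ᶜ :conj u) :*ᶜ u) := z₂ :* :∣ u ∣²)
          ≈-refl (re z) (im z) (re u) (im u) ⟩
      im z * n                               ∎)
    where
    open ≤-Reasoning
    r = re (z *ᶜ conj u)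
    i = im (z *ᶜ conj u)
    n = ∣ u ∣²

-- Polynomial identities in the Gram data.

module GramIdentities (em : ExcludedMiddle 0ℓ) (𝓡 : RealNumbers) where

  open Analysis em 𝓡
  open OrderedField em 𝓡
  open ComplexPolynomials em 𝓡

  module Gram (A B : ℝ) (C p q : ℂ) where

    D E : ℝ
    D = A * B - ∣ C ∣²
    E = ∣ q ∣² * A + ∣ p ∣² * B - 2ℝ * re (conj p *ᶜ q *ᶜ C)

    z u : ℂ
    z = conj p *ᶜ C -ᶜ conj q *ᶜ ofReal A
    u = conj q *ᶜ conj C -ᶜ conj p *ᶜ ofReal B

    -- The Gram form at coefficients `(1, α)`, which becomes the mean square of `L` times
    -- `M ⊹ α · N`.
    Q : ℂ → ℝ
    Q α = A + ∣ α ∣² * B + 2ℝ * re (conj α *ᶜ C)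

    -- Cauchy-Schwarz between the Gram form and its adjugate, with the defect explicit: it measures
    -- how far `(1, α)` is from being proportional to `(u, z)`.
    E*Q-identity : ∀ α → E * Q α ≈ ∣ p +ᶜ α *ᶜ q ∣² * D + ∣ z -ᶜ α *ᶜ u ∣²
    E*Q-identity α = solve 10 (λ A B C₁ C₂ p₁ p₂ q₁ q₂ α₁ α₂ →
        let C = C₁ , C₂; p = p₁ , p₂; q = q₁ , q₂; α = α₁ , α₂
            D = A :* B :- :∣ C ∣²
            E = :∣ q ∣² :* A :+ :∣ p ∣² :* B :- :2 :* :re (:conj p :*ᶜ q :*ᶜ C)
            z = :conj p :*ᶜ C :-ᶜ :conj q :*ᶜ :ofReal A
            u = :conj q :*ᶜ :conj C :-ᶜ :conj p :*ᶜ :ofReal B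
            Q = A :+ :∣ α ∣² :* B :+ :2 :* :re (:conj α :*ᶜ C)
        in E :* Q := :∣ p :+ᶜ α :*ᶜ q ∣² :* D :+ :∣ z :-ᶜ α :*ᶜ u ∣²)
      ≈-refl A B (re C) (im C) (re p) (im p) (re q) (im q) (re α) (im α)

    -- The preceding identity at `α = 0`, where `Q` takes the value `A`.
    E*A-identity : E * A ≈ ∣ p ∣² * D + ∣ z ∣²
    E*A-identity = solve 8 (λ A B C₁ C₂ p₁ p₂ q₁ q₂ →
        let C = C₁ , C₂; p = p₁ , p₂; q = q₁ , q₂
            D = A :* B :- :∣ C ∣²
            E = :∣ q ∣² :* A :+ :∣ p ∣² :* B :- :2 :* :re (:conj p :*ᶜ q :*ᶜ C)
            z = :conj p :*ᶜ C :-ᶜ :conj q :*ᶜ :ofReal A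
        in E :* A := :∣ p ∣² :* D :+ :∣ z ∣²)
      ≈-refl A B (re C) (im C) (re p) (im p) (re q) (im q)

    -- Completing the square in `α`. For positive `B` it bounds `Q` below by `D / B`, which makes
    -- every denominator in case (i) positive.
    Q*B-identity : ∀ α → Q α * B ≈ D + ∣ α *ᶜ ofReal B +ᶜ C ∣²
    Q*B-identity α = solve 6 (λ A B C₁ C₂ α₁ α₂ →
        let C = C₁ , C₂; α = α₁ , α₂ in
        (A :+ :∣ α ∣² :* B :+ :2 :* :re (:conj α :*ᶜ C)) :* B
        := (A :* B :- :∣ C ∣²) :+ :∣ α :*ᶜ :ofReal B :+ᶜ C ∣²)
      ≈-refl A B (re C) (im C) (re α) (im α)

    Q*A-identity : ∀ α → Q α * A ≈ ∣ ofReal A +ᶜ α *ᶜ conj C ∣² + ∣ α ∣² * D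
    Q*A-identity α = solve 6 (λ A B C₁ C₂ α₁ α₂ →
        let C = C₁ , C₂; α = α₁ , α₂ in
        (A :+ :∣ α ∣² :* B :+ :2 :* :re (:conj α :*ᶜ C)) :* A
        := :∣ :ofReal A :+ᶜ α :*ᶜ :conj C ∣² :+ :∣ α ∣² :* (A :* B :- :∣ C ∣²))
      ≈-refl A B (re C) (im C) (re α) (im α)

    -- Up to `≈ᶜ`, `z` is the conjugate of the difference whose vanishing separates cases (i) and
    -- (ii). In the same way `u` is the conjugate of `q C - p B`.
    ∣z∣²-conj : ∣ z ∣² ≈ ∣ p *ᶜ conj C -ᶜ q *ᶜ ofReal A ∣²
    ∣z∣²-conj = solve 7 (λ A C₁ C₂ p₁ p₂ q₁ q₂ →
        let C = C₁ , C₂; p = p₁ , p₂; q = q₁ , q₂ in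
        :∣ :conj p :*ᶜ C :-ᶜ :conj q :*ᶜ :ofReal A ∣² := :∣ p :*ᶜ :conj C :-ᶜ q :*ᶜ :ofReal A ∣²)
      ≈-refl A (re C) (im C) (re p) (im p) (re q) (im q)

    ∣u∣²-conj : ∣ u ∣² ≈ ∣ q *ᶜ C -ᶜ p *ᶜ ofReal B ∣²
    ∣u∣²-conj = solve 7 (λ B C₁ C₂ p₁ p₂ q₁ q₂ →
        let C = C₁ , C₂; p = p₁ , p₂; q = q₁ , q₂ in
        :∣ :conj q :*ᶜ :conj C :-ᶜ :conj p :*ᶜ :ofReal B ∣² := :∣ q :*ᶜ C :-ᶜ p :*ᶜ :ofReal B ∣²)
      ≈-refl B (re C) (im C) (re p) (im p) (re q) (im q)

    -- The last term is `α` times the quantity that vanishes in case (ii); keeping it makes the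
    -- statement an unconditional identity, open to the ring solver.
    combination-identity : ∀ α → (p +ᶜ α *ᶜ q) *ᶜ ofReal A
                                 ≈ᶜ p *ᶜ (ofReal A +ᶜ α *ᶜ conj C) -ᶜ α *ᶜ (p *ᶜ conj C -ᶜ q *ᶜ ofReal A)
    combination-identity α =
      solve 9 (λ A C₁ C₂ p₁ p₂ q₁ q₂ α₁ α₂ →
        let C = C₁ , C₂; p = p₁ , p₂; q = q₁ , q₂; α = α₁ , α₂ in
        :re ((p :+ᶜ α :*ᶜ q) :*ᶜ :ofReal A)
        := :re (p :*ᶜ (:ofReal A :+ᶜ α :*ᶜ :conj C) :-ᶜ α :*ᶜ (p :*ᶜ :conj C :-ᶜ q :*ᶜ :ofReal A)))
        ≈-refl A (re C) (im C) (re p) (im p) (re q) (im q) (re α) (im α) ,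
      solve 9 (λ A C₁ C₂ p₁ p₂ q₁ q₂ α₁ α₂ →
        let C = C₁ , C₂; p = p₁ , p₂; q = q₁ , q₂; α = α₁ , α₂ in
        :im ((p :+ᶜ α :*ᶜ q) :*ᶜ :ofReal A)
        := :im (p :*ᶜ (:ofReal A :+ᶜ α :*ᶜ :conj C) :-ᶜ α :*ᶜ (p :*ᶜ :conj C :-ᶜ q :*ᶜ :ofReal A)))
        ≈-refl A (re C) (im C) (re p) (im p) (re q) (im q) (re α) (im α)

    -- The value of the Gram form of (M, N) at (C̄, - A).
    A*D-identity : ∣ conj C ∣² * A + ∣ ofReal (- A) ∣² * B + 2ℝ * re (conj C *ᶜ conj (ofReal (- A)) *ᶜ C)
                   ≈ D * A
    A*D-identity = solve 4 (λ A B C₁ C₂ →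
        let C = C₁ , C₂ in
        :∣ :conj C ∣² :* A :+ :∣ :ofReal (:- A) ∣² :* B :+ :2 :* :re (:conj C :*ᶜ :conj (:ofReal (:- A)) :*ᶜ C)
        := (A :* B :- :∣ C ∣²) :* A)
      ≈-refl A B (re C) (im C)

    ∣C̄p-Aq∣²-identity : ∣ conj C *ᶜ p +ᶜ ofReal (- A) *ᶜ q ∣² ≈ ∣ z ∣²
    ∣C̄p-Aq∣²-identity = solve 7 (λ A C₁ C₂ p₁ p₂ q₁ q₂ →
        let C = C₁ , C₂; p = p₁ , p₂; q = q₁ , q₂ in
        :∣ :conj C :*ᶜ p :+ᶜ :ofReal (:- A) :*ᶜ q ∣² := :∣ :conj p :*ᶜ C :-ᶜ :conj q :*ᶜ :ofReal A ∣²)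
      ≈-refl A (re C) (im C) (re p) (im p) (re q) (im q)

-- Optimising the quotient from abstract Gram data.

module Optimization (em : ExcludedMiddle 0ℓ) (𝓡 : RealNumbers) where

  open Analysis em 𝓡
  open OrderedField em 𝓡
  open ComplexPolynomials em 𝓡
  open ComplexNumbers em 𝓡
  open GramIdentities em 𝓡

  -- The series are hidden: `β` is an arbitrary function of `α` known through two rules, its value
  -- where `Q` is positive and an upper bound that also covers the default value 0.
  module Quotient (p q C Ψ₂MM Ψ₂NN : ℂ) (A B βM βN : ℝ) (β : ℂ → ℝ)
    (Ψ₂MM≈A : Ψ₂MM ≈ᶜ ofReal A) (Ψ₂NN≈B : Ψ₂NN ≈ᶜ ofReal B)
    (∣p∣²-positive : 0ℝ < ∣ p ∣²) (A-positive : 0ℝ < A) (B-positive : 0ℝ < B)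
    (gram : ∀ x y → ∣ x *ᶜ p +ᶜ y *ᶜ q ∣² ≤ ∣ x ∣² * A + ∣ y ∣² * B + 2ℝ * re (x *ᶜ conj y *ᶜ C))
    (βN≤βM : βN ≤ βM) (βM*A≈∣p∣² : βM * A ≈ ∣ p ∣²) (βN*B≈∣q∣² : βN * B ≈ ∣ q ∣²)
    (β-value : ∀ α {V} → 0ℝ < Gram.Q A B C p q α →
               V * Gram.Q A B C p q α ≈ ∣ p +ᶜ α *ᶜ q ∣² → β α ≈ V)
    (β-upper : ∀ α {V} → 0ℝ ≤ V → ∣ p +ᶜ α *ᶜ q ∣² ≤ V * Gram.Q A B C p q α → β α ≤ V) where

    open Gram A B C p q

    -- Counterparts of `z` and `u` in the literal form of the theorem, with the complex `Ψ₂MM` and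
    -- `Ψ₂NN`. These agree with `ofReal A` and `ofReal B` only up to `≈ᶜ`, so both forms are
    -- carried.
    Z U : ℂ
    Z = conj p *ᶜ C -ᶜ conj q *ᶜ Ψ₂MM
    U = conj q *ᶜ conj C -ᶜ conj p *ᶜ Ψ₂NN

    V gain : ℝ
    V = E / D
    gain = ∣ Z ∣² / (A * D)

    -- The coefficients `(conj C, - A)` come from Gram-Schmidt: `C̄ M - A N` is orthogonal to `M`,
    -- which is why its mean square reduces to `D * A`.
    ∣z∣²≤D*A : ∣ z ∣² ≤ D * A
    ∣z∣²≤D*A =
      ≤-respˡ-≈ ∣C̄p-Aq∣²-identity (≤-respʳ-≈ A*D-identity (gram (conj C) (ofReal (- A))))

    D-nonNegative : 0ℝ ≤ D
    D-nonNegative = *-cancelʳ-nonNegative A-positive (≤-trans (∣∣²-nonNegative z) ∣z∣²≤D*A)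

    -- The comparison of `βN` with `βM`, cleared of denominators; in this form it excludes a
    -- vanishing denominator of `α₁`.
    ∣q∣²A≤∣p∣²B : ∣ q ∣² * A ≤ ∣ p ∣² * B
    ∣q∣²A≤∣p∣²B = begin
      ∣ q ∣² * A      ≈⟨ *-congʳ βN*B≈∣q∣² ⟨
      βN * B * A      ≈⟨ solve 3 (λ b x y → b :* x :* y := (x :* y) :* b) ≈-refl βN B A ⟩
      (B * A) * βN    ≤⟨ *-monoˡ-≤ (proj₁ (*-positive B-positive A-positive)) βN≤βM ⟩
      (B * A) * βM    ≈⟨ solve 3 (λ b x y → (x :* y) :* b := b :* y :* x) ≈-refl βM B A ⟩
      βM * A * B      ≈⟨ *-congʳ βM*A≈∣p∣² ⟩
      ∣ p ∣² * B      ∎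
      where open ≤-Reasoning

    module NonDegenerate (pC̄≉qΨ₂MM : p *ᶜ conj C ≉ᶜ q *ᶜ Ψ₂MM) where

      ∣z∣²-positive : 0ℝ < ∣ z ∣²
      ∣z∣²-positive = nonNegative∧≉0⇒positive (∣∣²-nonNegative z) λ |z|²≈0 →
        pC̄≉qΨ₂MM (≈ᶜ-trans (z-u≈0⇒z≈u (∣z∣²≈0⇒z≈0 (≈-trans (≈-sym ∣z∣²-conj) |z|²≈0)))
          (*ᶜ-cong {q} ≈ᶜ-refl (≈ᶜ-sym Ψ₂MM≈A)))

      D-positive : 0ℝ < D
      D-positive = *-cancelʳ-positive A-positive (<-≤-trans ∣z∣²-positive ∣z∣²≤D*A)

      A*D-positive : 0ℝ < A * D
      A*D-positive = *-positive A-positive D-positive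

      -- Otherwise |q|²|C|² = |p|²B² ≥ |q|²AB, whereas |C|² < AB.
      qC≉pB : q *ᶜ C ≉ᶜ p *ᶜ ofReal B
      qC≉pB qC≈pB = positive⇒≉0 (*-positive ∣p∣²-positive (*-positive B-positive B-positive))
        (≈-trans (≈-sym ∣q∣²∣C∣²≈∣p∣²B²) (≈-trans (*-congʳ ∣q∣²≈0) (zeroˡ _)))
        where
        open ≤-Reasoning
        ∣q∣²∣C∣²≈∣p∣²B² : ∣ q ∣² * ∣ C ∣² ≈ ∣ p ∣² * (B * B)
        ∣q∣²∣C∣²≈∣p∣²B² = ≈-trans (≈-sym (∣∣²-* q C)) (≈-trans (∣∣²-cong qC≈pB) (≈-trans (∣∣²-* p (ofReal B))
          (*-congˡ (solve 1 (λ b → b :* b :+ :0 :* :0 := b :* b) ≈-refl B))))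
        ∣q∣²AB≤∣q∣²∣C∣² : B * (∣ q ∣² * A) ≤ ∣ q ∣² * ∣ C ∣²
        ∣q∣²AB≤∣q∣²∣C∣² = begin
          B * (∣ q ∣² * A)     ≤⟨ *-monoˡ-≤ (proj₁ B-positive) ∣q∣²A≤∣p∣²B ⟩
          B * (∣ p ∣² * B)     ≈⟨ solve 2 (λ b x → b :* (x :* b) := x :* (b :* b)) ≈-refl B ∣ p ∣² ⟩
          ∣ p ∣² * (B * B)     ≈⟨ ∣q∣²∣C∣²≈∣p∣²B² ⟨
          ∣ q ∣² * ∣ C ∣²      ∎
        ∣q∣²D≤0 : ∣ q ∣² * D ≤ 0ℝ
        ∣q∣²D≤0 = ≤-intro (x≤y⇒0≤y-x ∣q∣²AB≤∣q∣²∣C∣²)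
          (solve 4 (λ x a b c → x :* (a :* b :- c) :+ (x :* c :- b :* (x :* a)) := :0)
            ≈-refl ∣ q ∣² A B ∣ C ∣²)
        ∣q∣²≈0 : ∣ q ∣² ≈ 0ℝ
        ∣q∣²≈0 = x*y≈0⇒x≈0 (antisym ∣q∣²D≤0 (*-nonNegative (∣∣²-nonNegative q) (proj₁ D-positive)))
          (positive⇒≉0 D-positive)

      qC≉pΨ₂NN : q *ᶜ C ≉ᶜ p *ᶜ Ψ₂NN
      qC≉pΨ₂NN eq = qC≉pB (≈ᶜ-trans eq (*ᶜ-cong {p} ≈ᶜ-refl Ψ₂NN≈B))

      Q-positive : ∀ α → 0ℝ < Q α
      Q-positive α = *-cancelʳ-positive B-positive
        (<-≤-trans D-positive (≤-intro (∣∣²-nonNegative (α *ᶜ ofReal B +ᶜ C)) (≈-sym (Q*B-identity α))))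

      V*D≈E : V * D ≈ E
      V*D≈E = x/y*y≈x (positive⇒≉0 D-positive)

      V-nonNegative : 0ℝ ≤ V
      V-nonNegative = /-nonNegative (*-cancelʳ-nonNegative A-positive (≤-respʳ-≈ (≈-sym E*A-identity)
        (+-nonNegative (*-nonNegative (∣∣²-nonNegative p) (proj₁ D-positive)) (∣∣²-nonNegative z)))) D-positive

      V*Q*D-identity : ∀ α → V * Q α * D ≈ ∣ p +ᶜ α *ᶜ q ∣² * D + ∣ z -ᶜ α *ᶜ u ∣²
      V*Q*D-identity α = ≈-trans (solve 3 (λ v q d → v :* q :* d := (v :* d) :* q) ≈-refl V (Q α) D)
        (≈-trans (*-congʳ V*D≈E) (E*Q-identity α))

      β≤V : ∀ α → β α ≤ V
      β≤V α = β-upper α V-nonNegative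
        (*-cancelʳ-≤ D-positive (≤-intro (∣∣²-nonNegative (z -ᶜ α *ᶜ u)) (≈-sym (V*Q*D-identity α))))

      Z≈z : Z ≈ᶜ z
      Z≈z = -ᶜ-cong ≈ᶜ-refl (*ᶜ-cong {conj q} ≈ᶜ-refl Ψ₂MM≈A)

      U≈u : U ≈ᶜ u
      U≈u = -ᶜ-cong ≈ᶜ-refl (*ᶜ-cong {conj p} ≈ᶜ-refl Ψ₂NN≈B)

      ∣U∣²≉0 : ¬ (∣ U ∣² ≈ 0ℝ)
      ∣U∣²≉0 |U|²≈0 = qC≉pB (z-u≈0⇒z≈u (∣z∣²≈0⇒z≈0
        (≈-trans (≈-sym ∣u∣²-conj) (≈-trans (∣∣²-cong (≈ᶜ-sym U≈u)) |U|²≈0))))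

      gain-positive : 0ℝ < gain
      gain-positive =
        /-positive (<-≤-trans ∣z∣²-positive (≤-reflexive (∣∣²-cong (≈ᶜ-sym Z≈z)))) A*D-positive

      -- Clearing the denominator `A * D` turns this into `E*A-identity`.
      V≈βM+gain : V ≈ βM + gain
      V≈βM+gain = *-cancelʳ-≈ (positive⇒≉0 A*D-positive) (begin-equality
        V * (A * D)
          ≈⟨ solve 3 (λ v a d → v :* (a :* d) := (v :* d) :* a) ≈-refl V A D ⟩
        V * D * A
          ≈⟨ *-congʳ V*D≈E ⟩
        E * A
          ≈⟨ E*A-identity ⟩
        ∣ p ∣² * D + ∣ z ∣²
          ≈⟨ +-cong (*-congʳ βM*A≈∣p∣²) (∣∣²-cong Z≈z) ⟨
        βM * A * D + ∣ Z ∣²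
          ≈⟨ +-congˡ (x/y*y≈x (positive⇒≉0 A*D-positive)) ⟨
        βM * A * D + gain * (A * D)
          ≈⟨ solve 4 (λ b a d g → b :* a :* d :+ g :* (a :* d) := (b :+ g) :* (a :* d))
               ≈-refl βM A D gain ⟩
        (βM + gain) * (A * D)
          ∎)
        where open ≤-Reasoning

      -- The optimum is given by its equation, so no complex division enters the argument.
      module _ {α₁ : ℂ} (α₁U≈Z : α₁ *ᶜ U ≈ᶜ Z) where

        ∣z-α₁u∣²≈0 : ∣ z -ᶜ α₁ *ᶜ u ∣² ≈ 0ℝ
        ∣z-α₁u∣²≈0 = ≈-trans (∣∣²-cong (-ᶜ-cong ≈ᶜ-refl
            (≈ᶜ-trans (*ᶜ-cong {α₁} ≈ᶜ-refl (≈ᶜ-sym U≈u)) (≈ᶜ-trans α₁U≈Z Z≈z))))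
          (solve 2 (λ a b → :∣ a :- a , b :- b ∣² := :0) ≈-refl (re z) (im z))

        β-max : β α₁ ≈ V
        β-max = β-value α₁ (Q-positive α₁)
          (*-cancelʳ-≈ (positive⇒≉0 D-positive)
            (≈-trans (V*Q*D-identity α₁) (≈-trans (+-congˡ ∣z-α₁u∣²≈0) (+-identityʳ _))))

        β≤β-max : ∀ α → β α ≤ β α₁
        β≤β-max α = ≤-respʳ-≈ (≈-sym β-max) (β≤V α)

        β-max≈βM+gain : β α₁ ≈ βM + gain
        β-max≈βM+gain = ≈-trans β-max V≈βM+gain

        βM<β-max : βM < β α₁
        βM<β-max = ≤-intro (proj₁ gain-positive) (≈-sym β-max≈βM+gain) ,
          λ eq → positive⇒≉0 gain-positive (begin-equality
            gain               ≈⟨ solve 2 (λ b g → g := (b :+ g) :- b) ≈-refl βM gain ⟩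
            βM + gain - βM     ≈⟨ +-congʳ (≈-trans (≈-sym β-max≈βM+gain) (≈-sym eq)) ⟩
            βM - βM            ≈⟨ -‿inverseʳ βM ⟩
            0ℝ                 ∎)
          where open ≤-Reasoning

        -- A literal Σ, unlike _×_, lets a caller's goal fix α₁ before α₁U≈Z is checked; the other
        -- order makes the type checker compare two unfolded copies of β.
        optimum :
          Σ (q *ᶜ C ≉ᶜ p *ᶜ Ψ₂NN) λ _ →
          (∀ α → β α ≤ β α₁)
          × (0ℝ < D)
          × (0ℝ < A * D)
          × (β α₁ ≈ V)
          × (β α₁ ≈ βM + gain)
          × (βM < β α₁)
        optimum =
          qC≉pΨ₂NN , β≤β-max , D-positive , A*D-positive , β-max , β-max≈βM+gain , βM<β-max

    βM≈∣p∣²/A : βM ≈ ∣ p ∣² / A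
    βM≈∣p∣²/A = ≈-sym (/-unique (positive⇒≉0 A-positive) βM*A≈∣p∣²)

    -- Here `D` may be zero and `Q α` may vanish, for instance when `N` is `M` and `α` is -1. The
    -- bound therefore passes through `β-upper`, in the multiplied form `∣ P ∣² ≤ V * Q α`, which is
    -- then checked after scaling by `A * A`.
    β≤βM : p *ᶜ conj C ≈ᶜ q *ᶜ Ψ₂MM → ∀ α → β α ≤ βM
    β≤βM pC̄≈qΨ₂MM α = ≤-respʳ-≈ (≈-sym βM≈∣p∣²/A)
      (β-upper α (/-nonNegative (∣∣²-nonNegative p) A-positive)
        (*-cancelʳ-≤ (*-positive A-positive A-positive) (begin
          ∣ P ∣² * (A * A)
            ≈⟨ *-congˡ (solve 1 (λ a → a :* a := a :* a :+ :0 :* :0) ≈-refl A) ⟩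
          ∣ P ∣² * ∣ ofReal A ∣²                           ≈⟨ ∣∣²-* P (ofReal A) ⟨
          ∣ P *ᶜ ofReal A ∣²                               ≈⟨ ∣∣²-cong P*A≈ ⟩
          ∣ p *ᶜ (ofReal A +ᶜ α *ᶜ conj C) ∣²              ≈⟨ ∣∣²-* p _ ⟩
          ∣ p ∣² * ∣ ofReal A +ᶜ α *ᶜ conj C ∣²
            ≤⟨ *-monoˡ-≤ (∣∣²-nonNegative p)
               (≤-intro (*-nonNegative (∣∣²-nonNegative α) D-nonNegative) (≈-sym (Q*A-identity α))) ⟩
          ∣ p ∣² * (Q α * A)
            ≈⟨ *-congʳ (x/y*y≈x (positive⇒≉0 A-positive)) ⟨
          ∣ p ∣² / A * A * (Q α * A)
            ≈⟨ solve 3 (λ v a q → v :* a :* (q :* a) := v :* q :* (a :* a)) ≈-refl (∣ p ∣² / A) A (Q α) ⟩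
          ∣ p ∣² / A * Q α * (A * A)                       ∎)))
      where
      open ≤-Reasoning
      P = p +ᶜ α *ᶜ q
      T = p *ᶜ (ofReal A +ᶜ α *ᶜ conj C)
      pC̄-qA≈0 : p *ᶜ conj C -ᶜ q *ᶜ ofReal A ≈ᶜ 0ᶜ
      pC̄-qA≈0 = ≈ᶜ-trans (-ᶜ-cong (≈ᶜ-trans pC̄≈qΨ₂MM (*ᶜ-cong {q} ≈ᶜ-refl Ψ₂MM≈A)) ≈ᶜ-refl)
        (-‿inverseʳ _ , -‿inverseʳ _)
      P*A≈ : P *ᶜ ofReal A ≈ᶜ T
      P*A≈ = ≈ᶜ-trans (combination-identity α) (≈ᶜ-trans (-ᶜ-cong ≈ᶜ-refl (*ᶜ-cong {α} ≈ᶜ-refl pC̄-qA≈0))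
        ( solve 3 (λ t a b → t :- (a :* :0 :- b :* :0) := t) ≈-refl (re T) (re α) (im α)
        , solve 3 (λ t a b → t :- (a :* :0 :+ b :* :0) := t) ≈-refl (im T) (re α) (im α)))

-- The Gram data of `M` and `N`, and the theorem.

module GramData (em : ExcludedMiddle 0ℓ) (𝓡 : RealNumbers) where

  open Analysis em 𝓡
  open OrderedField em 𝓡
  open ComplexPolynomials em 𝓡
  open ComplexNumbers em 𝓡

  module Pair {G : Set} (L : G → ℂ) (w : G → ℝ) (w≥0 : ∀ π → 0ℝ ≤ w π)
    (w≢0 : ¬ (∀ π → w π ≈ 0ℝ)) (w-summable : Summable (λ π → ofReal (w π)))
    (M N : G → ℂ)
    (M-summable : Weighted.SquareSummable L w M) (N-summable : Weighted.SquareSummable L w N)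
    (βN≤βM : Weighted.β L w N ≤ Weighted.β L w M)
    (ΨMΨ₂NN≉0 : Weighted.Ψ L w M *ᶜ Weighted.Ψ₂ L w N N ≉ᶜ 0ᶜ) where

    open Weighted L w
    open ComplexSeries em 𝓡 {G}
    open Means.WeightedMeans em 𝓡 L w w≥0 w≢0 w-summable

    hasMean⇒hasMean-𝔼 : ∀ {f} → ∃ (HasMeanᶜ f) → HasMeanᶜ f (𝔼 f)
    hasMean⇒hasMean-𝔼 (m , mean-re , mean-im) =
      mean-cong (λ _ → ≈-refl) (≈-sym (proj₁ 𝔼≈m)) mean-re ,
      mean-cong (λ _ → ≈-refl) (≈-sym (proj₂ 𝔼≈m)) mean-im
      where 𝔼≈m = hasMean⇒𝔼 (mean-re , mean-im)

    meanSquare⇒Ψ₂ : ∀ {F S} → HasMean (λ π → ∣ L π *ᶜ F π ∣²) S → Ψ₂ F F ≈ᶜ ofReal S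
    meanSquare⇒Ψ₂ {F} mean-sq = hasMean⇒𝔼
      ( mean-cong (λ π → solve 2 (λ a b → a :* a :+ b :* b := a :* a :- b :* :- b) ≈-refl
          (re (L π *ᶜ F π)) (im (L π *ᶜ F π))) ≈-refl mean-sq
      , mean-cong (λ π → solve 2 (λ a b → :0 := a :* :- b :+ b :* a) ≈-refl
          (re (L π *ᶜ F π)) (im (L π *ᶜ F π))) ≈-refl (mean-const 0ℝ))

    summable⇒squareIntegrable : ∀ {F} → SquareSummable F → SquareIntegrable (λ π → L π *ᶜ F π)
    summable⇒squareIntegrable (_ , sum) = _ , converges⇒hasMean (proj₁ (hasSum⇒converges sum))

    β-value : ∀ {F P S V} → HasMeanᶜ (λ π → L π *ᶜ F π) P → HasMean (λ π → ∣ L π *ᶜ F π ∣²) S →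
              0ℝ < S → V * S ≈ ∣ P ∣² → β F ≈ V
    β-value {F} {P} {S} {V} mean mean-sq 0<S VS≈|P|² with em {Ψ₂ F F ≈ᶜ 0ᶜ}
    ... | yes Ψ₂≈0 = ⊥-elim (positive⇒≉0 0<S (≈-trans (≈-sym (proj₁ (meanSquare⇒Ψ₂ mean-sq))) (proj₁ Ψ₂≈0)))
    ... | no _     = /-unique (λ eq → positive⇒≉0 0<S (≈-trans (≈-sym norm≈S) eq))
                       (≈-trans (*-congˡ norm≈S) (≈-trans VS≈|P|² (∣∣²-cong (≈ᶜ-sym (hasMean⇒𝔼 mean)))))
      where norm≈S = proj₁ (meanSquare⇒Ψ₂ {F} mean-sq)

    -- The condition `0ℝ ≤ V` takes care of the default value. Otherwise `Ψ₂ F F` is nonzero, and as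
    -- a mean of squares it is positive, so the quotient bound applies.
    β-upper : ∀ {F P S V} → HasMeanᶜ (λ π → L π *ᶜ F π) P → HasMean (λ π → ∣ L π *ᶜ F π ∣²) S →
              0ℝ ≤ V → ∣ P ∣² ≤ V * S → β F ≤ V
    β-upper {F} {P} {S} {V} mean mean-sq 0≤V |P|²≤VS with em {Ψ₂ F F ≈ᶜ 0ᶜ}
    ... | yes _   = 0≤V
    ... | no Ψ₂≉0 = /-upper
      (nonNegative∧≉0⇒positive (≤-respʳ-≈ (≈-sym (proj₁ Ψ₂≈S))
          (mean-nonNegative (λ π → ∣∣²-nonNegative (L π *ᶜ F π)) mean-sq))
        (λ eq → Ψ₂≉0 (eq , proj₂ Ψ₂≈S)))
      (≤-respˡ-≈ (∣∣²-cong (≈ᶜ-sym (hasMean⇒𝔼 mean))) (≤-respʳ-≈ (*-congˡ (≈-sym (proj₁ Ψ₂≈S))) |P|²≤VS))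
      where Ψ₂≈S = meanSquare⇒Ψ₂ {F} mean-sq

    A B : ℝ
    A = ‖ M ‖²
    B = ‖ N ‖²

    p q C : ℂ
    p = Ψ M
    q = Ψ N
    C = Ψ₂ M N

    open GramIdentities.Gram em 𝓡 A B C p q using (Q)

    integrable-M = summable⇒squareIntegrable {M} M-summable
    integrable-N = summable⇒squareIntegrable {N} N-summable

    Ψ₂MM≈A : Ψ₂ M M ≈ᶜ ofReal A
    Ψ₂MM≈A = ≈-refl , proj₂ (meanSquare⇒Ψ₂ {M} (proj₂ integrable-M))

    Ψ₂NN≈B : Ψ₂ N N ≈ᶜ ofReal B
    Ψ₂NN≈B = ≈-refl , proj₂ (meanSquare⇒Ψ₂ {N} (proj₂ integrable-N))

    mean-M : HasMeanᶜ (λ π → L π *ᶜ M π) p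
    mean-M = hasMean⇒hasMean-𝔼 (mean-exists integrable-M)

    mean-N : HasMeanᶜ (λ π → L π *ᶜ N π) q
    mean-N = hasMean⇒hasMean-𝔼 (mean-exists integrable-N)

    square-M : HasMean (λ π → ∣ L π *ᶜ M π ∣²) A
    square-M = mean-cong (λ _ → ≈-refl)
      (≈-sym (proj₁ (meanSquare⇒Ψ₂ {M} (proj₂ integrable-M)))) (proj₂ integrable-M)

    square-N : HasMean (λ π → ∣ L π *ᶜ N π ∣²) B
    square-N = mean-cong (λ _ → ≈-refl)
      (≈-sym (proj₁ (meanSquare⇒Ψ₂ {N} (proj₂ integrable-N)))) (proj₂ integrable-N)

    inner-MN : HasMeanᶜ (λ π → (L π *ᶜ M π) *ᶜ conj (L π *ᶜ N π)) C
    inner-MN = hasMean⇒hasMean-𝔼 (innerProduct-exists integrable-M integrable-N)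

    -- The explicit factor `ofReal 1ℝ` presents the family as the instance `x = 1`, `y = α` of the
    -- general linear combination.
    L*[M+αN] : ∀ α π → ofReal 1ℝ *ᶜ (L π *ᶜ M π) +ᶜ α *ᶜ (L π *ᶜ N π) ≈ᶜ L π *ᶜ (M ⊹ α · N) π
    L*[M+αN] α π =
      solve 8 (λ α₁ α₂ l₁ l₂ m₁ m₂ n₁ n₂ → let α = α₁ , α₂; l = l₁ , l₂; m = m₁ , m₂; n = n₁ , n₂ in
        :re (:ofReal :1 :*ᶜ (l :*ᶜ m) :+ᶜ α :*ᶜ (l :*ᶜ n)) := :re (l :*ᶜ (m :+ᶜ α :*ᶜ n)))
        ≈-refl (re α) (im α) (re (L π)) (im (L π)) (re (M π)) (im (M π)) (re (N π)) (im (N π)) ,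
      solve 8 (λ α₁ α₂ l₁ l₂ m₁ m₂ n₁ n₂ → let α = α₁ , α₂; l = l₁ , l₂; m = m₁ , m₂; n = n₁ , n₂ in
        :im (:ofReal :1 :*ᶜ (l :*ᶜ m) :+ᶜ α :*ᶜ (l :*ᶜ n)) := :im (l :*ᶜ (m :+ᶜ α :*ᶜ n)))
        ≈-refl (re α) (im α) (re (L π)) (im (L π)) (re (M π)) (im (M π)) (re (N π)) (im (N π))

    1*z≈z : ∀ z → ofReal 1ℝ *ᶜ z ≈ᶜ z
    1*z≈z z = solve 2 (λ a b → :1 :* a :- :0 :* b := a) ≈-refl (re z) (im z) ,
              solve 2 (λ a b → :1 :* b :+ :0 :* a := b) ≈-refl (re z) (im z)

    mean-M+αN : ∀ α → HasMeanᶜ (λ π → L π *ᶜ (M ⊹ α · N) π) (p +ᶜ α *ᶜ q)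
    mean-M+αN α = mean-cong (λ π → proj₁ (L*[M+αN] α π)) (proj₁ 1*p+αq≈) (proj₁ mean) ,
                  mean-cong (λ π → proj₂ (L*[M+αN] α π)) (proj₂ 1*p+αq≈) (proj₂ mean)
      where
      mean = combination-mean mean-M mean-N square-M square-N inner-MN (ofReal 1ℝ) α
      1*p+αq≈ : ofReal 1ℝ *ᶜ p +ᶜ α *ᶜ q ≈ᶜ p +ᶜ α *ᶜ q
      1*p+αq≈ = +ᶜ-cong (1*z≈z p) ≈ᶜ-refl

    square-M+αN : ∀ α → HasMean (λ π → ∣ L π *ᶜ (M ⊹ α · N) π ∣²) (Q α)
    square-M+αN α = mean-cong (λ π → ∣∣²-cong (L*[M+αN] α π))
      (solve 6 (λ A B C₁ C₂ α₁ α₂ → let C = C₁ , C₂; α = α₁ , α₂ in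
        :∣ :ofReal :1 ∣² :* A :+ :∣ α ∣² :* B :+ :2 :* :re (:ofReal :1 :*ᶜ :conj α :*ᶜ C)
        := A :+ :∣ α ∣² :* B :+ :2 :* :re (:conj α :*ᶜ C))
        ≈-refl A B (re C) (im C) (re α) (im α))
      (combination-square mean-M mean-N square-M square-N inner-MN (ofReal 1ℝ) α)

    ∣p∣²-positive : 0ℝ < ∣ p ∣²
    ∣p∣²-positive = nonNegative∧≉0⇒positive (∣∣²-nonNegative p) λ |p|²≈0 →
      ΨMΨ₂NN≉0 (≈ᶜ-trans (*ᶜ-cong (∣z∣²≈0⇒z≈0 |p|²≈0) ≈ᶜ-refl)
        ( solve 2 (λ a b → :0 :* a :- :0 :* b := :0) ≈-refl _ _
        , solve 2 (λ a b → :0 :* b :+ :0 :* a := :0) ≈-refl (re (Ψ₂ N N)) _))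

    -- The variance inequality passes positivity from `∣ p ∣²` to `A`. The mean `q` may vanish, so
    -- for `B` strictness comes from `Ψ₂ N N` being nonzero.
    A-positive : 0ℝ < A
    A-positive = <-≤-trans ∣p∣²-positive (∣mean∣²≤meanSquare mean-M square-M)

    B-positive : 0ℝ < B
    B-positive = nonNegative∧≉0⇒positive
      (≤-trans (∣∣²-nonNegative q) (∣mean∣²≤meanSquare mean-N square-N)) λ B≈0 →
      ΨMΨ₂NN≉0 (≈ᶜ-trans (*ᶜ-cong {p} ≈ᶜ-refl (≈ᶜ-trans Ψ₂NN≈B (B≈0 , ≈-refl)))
        ( solve 2 (λ a b → a :* :0 :- b :* :0 := :0) ≈-refl (re p) (im p)
        , solve 2 (λ a b → a :* :0 :+ b :* :0 := :0) ≈-refl (re p) (im p)))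

    βM*A≈∣p∣² : β M * A ≈ ∣ p ∣²
    βM*A≈∣p∣² = ≈-trans (*-congʳ (β-value mean-M square-M A-positive ∣p∣²/A*A≈∣p∣²)) ∣p∣²/A*A≈∣p∣²
      where ∣p∣²/A*A≈∣p∣² = x/y*y≈x (positive⇒≉0 A-positive)

    βN*B≈∣q∣² : β N * B ≈ ∣ q ∣²
    βN*B≈∣q∣² = ≈-trans (*-congʳ (β-value mean-N square-N B-positive ∣q∣²/B*B≈∣q∣²)) ∣q∣²/B*B≈∣q∣²
      where ∣q∣²/B*B≈∣q∣² = x/y*y≈x (positive⇒≉0 B-positive)

    open Optimization.Quotient em 𝓡 p q C (Ψ₂ M M) (Ψ₂ N N) A B (β M) (β N)
      (λ α → β (M ⊹ α · N)) Ψ₂MM≈A Ψ₂NN≈B ∣p∣²-positive A-positive B-positive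
      (gram-inequality mean-M mean-N square-M square-N inner-MN)
      βN≤βM βM*A≈∣p∣² βN*B≈∣q∣²
      (λ α → β-value (mean-M+αN α) (square-M+αN α))
      (λ α → β-upper (mean-M+αN α) (square-M+αN α)) public
      using (module NonDegenerate; β≤βM)

corollary2p6 :
  (em : ExcludedMiddle 0ℓ) (𝓡 : RealNumbers) →
  let open Analysis em 𝓡 in
  (G : Set) (L : G → ℂ) (w : G → ℝ) →
  let open Weighted L w in
  (∀ π → 0ℝ ≤ w π) →
  ¬ (∀ π → w π ≈ 0ℝ) →
  Summable (λ π → ofReal (w π)) →
  (M N : G → ℂ) →
  SquareSummable M →
  SquareSummable N →
  β N ≤ β M →
  Ψ M *ᶜ Ψ₂ N N ≉ᶜ 0ᶜ →
  let
    α₁ : ℂ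
    α₁ = (conj (Ψ M) *ᶜ Ψ₂ M N -ᶜ conj (Ψ N) *ᶜ Ψ₂ M M)
         /ᶜ (conj (Ψ N) *ᶜ conj (Ψ₂ M N) -ᶜ conj (Ψ M) *ᶜ Ψ₂ N N)
    D : ℝ
    D = ‖ M ‖² * ‖ N ‖² - ∣ Ψ₂ M N ∣²
  in
  (Ψ M *ᶜ conj (Ψ₂ M N) ≉ᶜ Ψ N *ᶜ Ψ₂ M M →
     (Ψ N *ᶜ Ψ₂ M N ≉ᶜ Ψ M *ᶜ Ψ₂ N N)
     × (∀ α → β (M ⊹ α · N) ≤ β (M ⊹ α₁ · N))
     × (0ℝ < D)
     × (0ℝ < ‖ M ‖² * D)
     × (β (M ⊹ α₁ · N)
          ≈ (∣ Ψ N ∣² * ‖ M ‖² + ∣ Ψ M ∣² * ‖ N ‖²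
             - (1ℝ + 1ℝ) * re (conj (Ψ M) *ᶜ Ψ N *ᶜ Ψ₂ M N)) / D)
     × (β (M ⊹ α₁ · N)
          ≈ β M + ∣ conj (Ψ M) *ᶜ Ψ₂ M N -ᶜ conj (Ψ N) *ᶜ Ψ₂ M M ∣²
                  / (‖ M ‖² * D))
     × (β M < β (M ⊹ α₁ · N)))
  ×
  (Ψ M *ᶜ conj (Ψ₂ M N) ≈ᶜ Ψ N *ᶜ Ψ₂ M M →
     ∀ α → β (M ⊹ α · N) ≤ β M)
corollary2p6 em 𝓡 G L w w≥0 w≢0 w-summable M N M-summable N-summable βN≤βM ΨMΨ₂NN≉0 =
  -- Since `U` is nonzero, the quotient in the statement solves `α₁ *ᶜ U ≈ᶜ Z`.
  (λ pC̄≉qΨ₂MM → P.NonDegenerate.optimum pC̄≉qΨ₂MM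
    (ComplexNumbers.z/u*u≈z em 𝓡 (P.NonDegenerate.∣U∣²≉0 pC̄≉qΨ₂MM))) ,
  P.β≤βM
  where
  module P = GramData.Pair em 𝓡 L w w≥0 w≢0 w-summable M N M-summable N-summable βN≤βM ΨMΨ₂NN≉0
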